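{- Let $A_1,A_2,Z$ be finite subsets of $\mathbb{R}$ with $|A_1|\le |A_2|$ and $|Z|\lesssim |A_1|^2$. Then \[ R(Z;A_1,A_2)\lesssim |A_1|^{10/3}|A_2|^{8/3}, \] where the implied constants may depend on the implied constant in the hypothesis $|Z|\lesssim|A_1|^2$.
   Context: $R(Z;A_1,A_2)$ is the number of 8-tuples $(a_1,a_2,a_1',a_2',a_1'',a_2'',a_1''',a_2''')$ with $a_i,a_i',a_i'',a_i'''\in A_i$ ($i=1,2$) and nonzero denominators such that \[ \frac{a_1+a_2}{a_1'+a_2'}=\frac{a_1''+a_2''}{a_1'''+a_2'''}\in Z . \] Notation: $X\lesssim Y$ means $X\le C\,Y(\log(2+N))^{c}$ for some absolute constants $C,c>0$, where $N$ is the largest cardinality of the finite sets in the statement; $X\gtrsim Y$ means $Y\lesssim X$. -}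

module Defs where

open import Data.Fin using (Fin)
open import Data.Nat as ℕ using (ℕ)
import Data.Nat.Properties as ℕₚ
open import Data.Nat.Logarithm using (⌊log₂_⌋)
open import Data.Product using (Σ; ∃; _×_; _,_; proj₁; proj₂)
open import Data.Rational hiding (_≃_)
open import Data.Rational.Properties
open import Data.Rational.Solver using (module +-*-Solver)
open import Function.Definitions using (Injective)
open import Relation.Binary.PropositionalEquality

-- Real numbers are Cauchy sequences of rationals; their equality is _≃_.

IsCauchy : (ℕ → ℚ) → Set
IsCauchy x = ∀ (ε : ℚ) → 0ℚ < ε →
  ∃ λ N → ∀ m n → N ℕ.≤ m → N ℕ.≤ n → ∣ x m - x n ∣ ≤ ε

record ℝ : Set where
  constructor mkℝ
  field
    seq    : ℕ → ℚ
    cauchy : IsCauchy seq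

open ℝ public

infix 4 _≃_ _≄0

_≃_ : ℝ → ℝ → Set
x ≃ y = ∀ (ε : ℚ) → 0ℚ < ε →
  ∃ λ N → ∀ n → N ℕ.≤ n → ∣ seq x n - seq y n ∣ ≤ ε

-- Apartness from zero, the form of being nonzero that allows division.
-- Classically it is the same as ¬ (x ≃ 0).
_≄0 : ℝ → Set
x ≄0 = Σ ℚ λ δ → 0ℚ < δ × ∃ λ N → ∀ n → N ℕ.≤ n → δ ≤ ∣ seq x n ∣

∣p*q∣≤b*e : ∀ p q {b e} → ∣ p ∣ ≤ b → ∣ q ∣ ≤ e → ∣ p * q ∣ ≤ b * e
∣p*q∣≤b*e p q {b} {e} p≤b q≤e = begin
  ∣ p * q ∣      ≡⟨ ∣p*q∣≡∣p∣*∣q∣ p q ⟩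
  ∣ p ∣ * ∣ q ∣  ≤⟨ *-monoˡ-≤-nonNeg ∣ p ∣ {{∣-∣-nonNeg p}} q≤e ⟩
  ∣ p ∣ * e      ≤⟨ *-monoʳ-≤-nonNeg e {{nonNegative (≤-trans (0≤∣p∣ q) q≤e)}} p≤b ⟩
  b * e          ∎
  where open ≤-Reasoning

∣sum-difference∣≤ : ∀ a b c d {e f} → ∣ a - c ∣ ≤ e → ∣ b - d ∣ ≤ f →
                    ∣ (a + b) - (c + d) ∣ ≤ e + f
∣sum-difference∣≤ a b c d {e} {f} p q = begin
  ∣ (a + b) - (c + d) ∣      ≡⟨ cong ∣_∣ (rearrange a b c d) ⟩
  ∣ (a - c) + (b - d) ∣      ≤⟨ ∣p+q∣≤∣p∣+∣q∣ (a - c) (b - d) ⟩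
  ∣ a - c ∣ + ∣ b - d ∣      ≤⟨ +-mono-≤ p q ⟩
  e + f                      ∎
  where
  open ≤-Reasoning
  rearrange : ∀ a b c d → (a + b) - (c + d) ≡ (a - c) + (b - d)
  rearrange = solve 4 (λ a b c d →
    (a :+ b) :- (c :+ d) := (a :- c) :+ (b :- d)) refl
    where open +-*-Solver

∣product-difference∣≤ : ∀ a b c d {B D e f} →
  ∣ a ∣ ≤ B → ∣ b - d ∣ ≤ e → ∣ d ∣ ≤ D → ∣ a - c ∣ ≤ f →
  ∣ a * b - c * d ∣ ≤ B * e + D * f
∣product-difference∣≤ a b c d {B} {D} {e} {f} a≤B b-d≤e d≤D a-c≤f = begin
  ∣ a * b - c * d ∣                  ≡⟨ cong ∣_∣ (rearrange a b c d) ⟩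
  ∣ a * (b - d) + d * (a - c) ∣      ≤⟨ ∣p+q∣≤∣p∣+∣q∣ (a * (b - d)) (d * (a - c)) ⟩
  ∣ a * (b - d) ∣ + ∣ d * (a - c) ∣  ≤⟨ +-mono-≤ (∣p*q∣≤b*e a (b - d) a≤B b-d≤e)
                                                 (∣p*q∣≤b*e d (a - c) d≤D a-c≤f) ⟩
  B * e + D * f                      ∎
  where
  open ≤-Reasoning
  rearrange : ∀ a b c d → a * b - c * d ≡ a * (b - d) + d * (a - c)
  rearrange = solve 4 (λ a b c d →
    a :* b :- c :* d := a :* (b :- d) :+ d :* (a :- c)) refl
    where open +-*-Solver

∣p∣≤∣q∣+∣p-q∣ : ∀ p q → ∣ p ∣ ≤ ∣ q ∣ + ∣ p - q ∣
∣p∣≤∣q∣+∣p-q∣ p q = begin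
  ∣ p ∣              ≡⟨ cong ∣_∣ (split p q) ⟩
  ∣ q + (p - q) ∣    ≤⟨ ∣p+q∣≤∣p∣+∣q∣ q (p - q) ⟩
  ∣ q ∣ + ∣ p - q ∣  ∎
  where
  open ≤-Reasoning
  split : ∀ p q → p ≡ q + (p - q)
  split = solve 2 (λ p q → p := q :+ (p :- q)) refl
    where open +-*-Solver

-- Abstract because unfolding ℚ arithmetic in these moduli makes type
-- checking intractable.
abstract
  scale : ∀ b ε → 0ℚ < b → 0ℚ < ε → Σ ℚ λ ε′ → 0ℚ < ε′ × b * ε′ ≡ ε
  scale b ε 0<b 0<ε = b⁻¹ * ε , 0<b⁻¹*ε , b*[b⁻¹*ε]≡ε
    where
    b-pos : Positive b
    b-pos = positive 0<b

    b⁻¹ : ℚ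
    b⁻¹ = (1/ b) {{pos⇒nonZero b {{b-pos}}}}

    0<b⁻¹*ε : 0ℚ < b⁻¹ * ε
    0<b⁻¹*ε = positive⁻¹ (b⁻¹ * ε)
      {{pos*pos⇒pos b⁻¹ {{1/pos⇒pos b {{b-pos}}}} ε {{positive 0<ε}}}}

    b*[b⁻¹*ε]≡ε : b * (b⁻¹ * ε) ≡ ε
    b*[b⁻¹*ε]≡ε = begin
      b * (b⁻¹ * ε)  ≡⟨ *-assoc b b⁻¹ ε ⟨
      b * b⁻¹ * ε    ≡⟨ cong (_* ε) (*-inverseʳ b {{pos⇒nonZero b {{b-pos}}}}) ⟩
      1ℚ * ε         ≡⟨ *-identityˡ ε ⟩
      ε              ∎
      where open ≡-Reasoning

  halve : ∀ ε → 0ℚ < ε → Σ ℚ λ η → 0ℚ < η × η + η ≡ ε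
  halve ε 0<ε = ½ * ε , 0<½*ε , ½*ε+½*ε≡ε
    where
    0<½*ε : 0ℚ < ½ * ε
    0<½*ε = positive⁻¹ (½ * ε) {{pos*pos⇒pos ½ ε {{positive 0<ε}}}}

    ½*ε+½*ε≡ε : ½ * ε + ½ * ε ≡ ε
    ½*ε+½*ε≡ε = trans (sym (*-distribʳ-+ ε ½ ½)) (*-identityˡ ε)

+-cauchy : ∀ x y → IsCauchy x → IsCauchy y → IsCauchy (λ n → x n + y n)
+-cauchy x y cx cy ε 0<ε with halve ε 0<ε
... | η , 0<η , η+η≡ε with cx η 0<η | cy η 0<η
... | M , hx | N , hy = M ℕ.⊔ N , λ m n p q →
  subst (∣ (x m + y m) - (x n + y n) ∣ ≤_) η+η≡ε
    (∣sum-difference∣≤ (x m) (y m) (x n) (y n) {η} {η}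
      (hx m n (ℕₚ.m⊔n≤o⇒m≤o M N p) (ℕₚ.m⊔n≤o⇒m≤o M N q))
      (hy m n (ℕₚ.m⊔n≤o⇒n≤o M N p) (ℕₚ.m⊔n≤o⇒n≤o M N q)))

eventually-bounded : ∀ x → IsCauchy x →
  Σ ℚ λ B → 0ℚ < B × ∃ λ N → ∀ n → N ℕ.≤ n → ∣ x n ∣ ≤ B
eventually-bounded x cx with cx 1ℚ (positive⁻¹ 1ℚ)
... | N , h = ∣ x N ∣ + 1ℚ , 0<B , N , λ n p →
  ≤-trans (∣p∣≤∣q∣+∣p-q∣ (x n) (x N)) (+-monoʳ-≤ ∣ x N ∣ (h n N p ℕₚ.≤-refl))
  where
  0<B : 0ℚ < ∣ x N ∣ + 1ℚ
  0<B = +-mono-≤-< (0≤∣p∣ (x N)) (positive⁻¹ 1ℚ)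

*-cauchy : ∀ x y → IsCauchy x → IsCauchy y → IsCauchy (λ n → x n * y n)
*-cauchy x y cx cy ε 0<ε =
  let η , 0<η , η+η≡ε   = halve ε 0<ε
      B , 0<B , K , x≤B = eventually-bounded x cx
      D , 0<D , L , y≤D = eventually-bounded y cy
      e , 0<e , B*e≡η   = scale B η 0<B 0<η
      f , 0<f , D*f≡η   = scale D η 0<D 0<η
      M , hx            = cx f 0<f
      N , hy            = cy e 0<e
  in (K ℕ.⊔ L) ℕ.⊔ (M ℕ.⊔ N) ,
     bound η B D e f K L M N η+η≡ε B*e≡η D*f≡η x≤B y≤D hx hy
  where
  bound : ∀ η B D e f K L M N → η + η ≡ ε → B * e ≡ η → D * f ≡ η →
    (∀ n → K ℕ.≤ n → ∣ x n ∣ ≤ B) →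
    (∀ n → L ℕ.≤ n → ∣ y n ∣ ≤ D) →
    (∀ m n → M ℕ.≤ m → M ℕ.≤ n → ∣ x m - x n ∣ ≤ f) →
    (∀ m n → N ℕ.≤ m → N ℕ.≤ n → ∣ y m - y n ∣ ≤ e) →
    ∀ m n → (K ℕ.⊔ L) ℕ.⊔ (M ℕ.⊔ N) ℕ.≤ m → (K ℕ.⊔ L) ℕ.⊔ (M ℕ.⊔ N) ℕ.≤ n →
    ∣ x m * y m - x n * y n ∣ ≤ ε
  bound η B D e f K L M N η+η≡ε B*e≡η D*f≡η x≤B y≤D hx hy m n p q = begin
    ∣ x m * y m - x n * y n ∣
      ≤⟨ ∣product-difference∣≤ (x m) (y m) (x n) (y n) {B} {D} {e} {f}
           (x≤B m (ℕₚ.m⊔n≤o⇒m≤o K L p₁))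
           (hy m n (ℕₚ.m⊔n≤o⇒n≤o M N p₂) (ℕₚ.m⊔n≤o⇒n≤o M N q₂))
           (y≤D n (ℕₚ.m⊔n≤o⇒n≤o K L q₁))
           (hx m n (ℕₚ.m⊔n≤o⇒m≤o M N p₂) (ℕₚ.m⊔n≤o⇒m≤o M N q₂)) ⟩
    B * e + D * f
      ≡⟨ cong₂ _+_ {B * e} {η} {D * f} {η} B*e≡η D*f≡η ⟩
    η + η
      ≡⟨ η+η≡ε ⟩
    ε ∎
    where
    open ≤-Reasoning
    p₁ = ℕₚ.m⊔n≤o⇒m≤o (K ℕ.⊔ L) (M ℕ.⊔ N) p
    p₂ = ℕₚ.m⊔n≤o⇒n≤o (K ℕ.⊔ L) (M ℕ.⊔ N) p
    q₁ = ℕₚ.m⊔n≤o⇒m≤o (K ℕ.⊔ L) (M ℕ.⊔ N) q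
    q₂ = ℕₚ.m⊔n≤o⇒n≤o (K ℕ.⊔ L) (M ℕ.⊔ N) q

apart⇒nonZero : ∀ {δ} q → 0ℚ < δ → δ ≤ ∣ q ∣ → NonZero q
apart⇒nonZero q 0<δ δ≤∣q∣ = ≢-nonZero λ q≡0 →
  <-irrefl (sym (cong ∣_∣ q≡0)) (<-≤-trans 0<δ δ≤∣q∣)

∣1/q∣≤ : ∀ {δ κ} q → .{{_ : NonZero q}} → 0ℚ < δ → δ * κ ≡ 1ℚ → δ ≤ ∣ q ∣ →
         ∣ 1/ q ∣ ≤ κ
∣1/q∣≤ {δ} {κ} q 0<δ δ*κ≡1 δ≤∣q∣ = *-cancelˡ-≤-pos δ {{positive 0<δ}} (begin
  δ * ∣ 1/ q ∣      ≤⟨ *-monoʳ-≤-nonNeg ∣ 1/ q ∣ {{∣-∣-nonNeg (1/ q)}} δ≤∣q∣ ⟩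
  ∣ q ∣ * ∣ 1/ q ∣  ≡⟨ ∣p*q∣≡∣p∣*∣q∣ q (1/ q) ⟨
  ∣ q * 1/ q ∣      ≡⟨ cong ∣_∣ (*-inverseʳ q) ⟩
  1ℚ                ≡⟨ δ*κ≡1 ⟨
  δ * κ             ∎)
  where open ≤-Reasoning

1/-difference : ∀ p q → .{{_ : NonZero p}} .{{_ : NonZero q}} →
                1/ p - 1/ q ≡ 1/ p * (1/ q * (q - p))
1/-difference p q = sym (begin
  1/ p * (1/ q * (q - p))
    ≡⟨ rearrange (1/ p) (1/ q) p q ⟩
  1/ p * (1/ q * q) - 1/ q * (1/ p * p)
    ≡⟨ cong₂ (λ s t → 1/ p * s - 1/ q * t) (*-inverseˡ q) (*-inverseˡ p) ⟩
  1/ p * 1ℚ - 1/ q * 1ℚ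
    ≡⟨ cong₂ _-_ (*-identityʳ (1/ p)) (*-identityʳ (1/ q)) ⟩
  1/ p - 1/ q ∎)
  where
  open ≡-Reasoning
  rearrange : ∀ a b p q → a * (b * (q - p)) ≡ a * (b * q) - b * (a * p)
  rearrange = solve 4 (λ a b p q →
    a :* (b :* (q :- p)) := a :* (b :* q) :- b :* (a :* p)) refl
    where open +-*-Solver

∣1/-difference∣≤ : ∀ {δ κ e} p q → .{{_ : NonZero p}} .{{_ : NonZero q}} →
  0ℚ < δ → δ * κ ≡ 1ℚ → δ ≤ ∣ p ∣ → δ ≤ ∣ q ∣ → ∣ q - p ∣ ≤ e →
  ∣ 1/ p - 1/ q ∣ ≤ κ * (κ * e)
∣1/-difference∣≤ {δ} {κ} {e} p q 0<δ δ*κ≡1 δ≤p δ≤q q-p≤e =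
  subst (λ t → ∣ t ∣ ≤ κ * (κ * e)) (sym (1/-difference p q))
    (∣p*q∣≤b*e (1/ p) (1/ q * (q - p)) {κ} {κ * e} (∣1/q∣≤ p 0<δ δ*κ≡1 δ≤p)
      (∣p*q∣≤b*e (1/ q) (q - p) {κ} {e} (∣1/q∣≤ q 0<δ δ*κ≡1 δ≤q) q-p≤e))

infixl 6 _⊕_
infixl 7 _⊗_

_⊕_ : ℝ → ℝ → ℝ
x ⊕ y = mkℝ (λ n → seq x n + seq y n) (+-cauchy (seq x) (seq y) (cauchy x) (cauchy y))

_⊗_ : ℝ → ℝ → ℝ
x ⊗ y = mkℝ (λ n → seq x n * seq y n) (*-cauchy (seq x) (seq y) (cauchy x) (cauchy y))

-- The terms of the inverse are 1/xₙ, starting from the index beyond which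
-- xₙ is known to be bounded away from 0.
inverse : (x : ℝ) → x ≄0 → ℝ
inverse x (δ , 0<δ , N , δ≤∣x∣) = mkℝ inv inv-cauchy
  where
  apart : ∀ n → δ ≤ ∣ seq x (N ℕ.+ n) ∣
  apart n = δ≤∣x∣ (N ℕ.+ n) (ℕₚ.m≤m+n N n)

  nz : ∀ n → NonZero (seq x (N ℕ.+ n))
  nz n = apart⇒nonZero (seq x (N ℕ.+ n)) 0<δ (apart n)

  inv : ℕ → ℚ
  inv n = (1/ seq x (N ℕ.+ n)) {{nz n}}

  inv-cauchy : IsCauchy inv
  inv-cauchy ε 0<ε with scale δ 1ℚ 0<δ (positive⁻¹ 1ℚ)
  ... | κ , 0<κ , δ*κ≡1 with scale κ ε 0<κ 0<ε
  ... | ε′ , 0<ε′ , κ*ε′≡ε with scale κ ε′ 0<κ 0<ε′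
  ... | ε″ , 0<ε″ , κ*ε″≡ε′ with cauchy x ε″ 0<ε″
  ... | M , h = M , λ m n p q →
    subst (∣ inv m - inv n ∣ ≤_)
      (trans (cong (κ *_) {κ * ε″} {ε′} κ*ε″≡ε′) κ*ε′≡ε)
      (∣1/-difference∣≤ {δ} {κ} {ε″} (seq x (N ℕ.+ m)) (seq x (N ℕ.+ n)) {{nz m}} {{nz n}}
        0<δ δ*κ≡1 (apart m) (apart n)
        (h (N ℕ.+ n) (N ℕ.+ m)
          (ℕₚ.≤-trans q (ℕₚ.m≤n+m n N)) (ℕₚ.≤-trans p (ℕₚ.m≤n+m m N))))

quotient : (x y : ℝ) → y ≄0 → ℝ
quotient x y y≄0 = x ⊗ inverse y y≄0

record FiniteSubset : Set where
  field
    card      : ℕ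
    elem      : Fin card → ℝ
    injective : Injective _≡_ _≃_ elem

open FiniteSubset public

infix 4 _∈_
_∈_ : ℝ → FiniteSubset → Set
x ∈ A = ∃ λ i → x ≃ elem A i

-- 8-tuples (a₁ , a₂ , a₁′ , a₂′ , a₁″ , a₂″ , a₁‴ , a₂‴).  An element of Aᵢ
-- is represented by its index, so distinct tuples are distinct for _≡_.
Octuple : FiniteSubset → FiniteSubset → Set
Octuple A₁ A₂ = I₁ × I₂ × I₁ × I₂ × I₁ × I₂ × I₁ × I₂
  where
  I₁ = Fin (card A₁)
  I₂ = Fin (card A₂)

IsSolution : (Z A₁ A₂ : FiniteSubset) → Octuple A₁ A₂ → Set
IsSolution Z A₁ A₂ (a₁ , a₂ , a₁′ , a₂′ , a₁″ , a₂″ , a₁‴ , a₂‴) =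
  Σ (s a₁′ a₂′ ≄0) λ nz′ → Σ (s a₁‴ a₂‴ ≄0) λ nz‴ →
    quotient (s a₁ a₂) (s a₁′ a₂′) nz′ ≃ quotient (s a₁″ a₂″) (s a₁‴ a₂‴) nz‴
    × quotient (s a₁ a₂) (s a₁′ a₂′) nz′ ∈ Z
  where
  s : Fin (card A₁) → Fin (card A₂) → ℝ
  s i j = elem A₁ i ⊕ elem A₂ j

-- R≥ Z A₁ A₂ r says r ≤ R(Z; A₁, A₂): there are r distinct solutions.
-- Since equality of reals is undecidable, the number of solutions is not
-- available as a function into ℕ; an upper bound for R(Z; A₁, A₂) is a bound
-- for every r with R≥ Z A₁ A₂ r.
R≥ : (Z A₁ A₂ : FiniteSubset) → ℕ → Set
R≥ Z A₁ A₂ r = Σ (Fin r → Octuple A₁ A₂) λ t →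
  Injective _≡_ _≡_ t × (∀ i → IsSolution Z A₁ A₂ (t i))

-- The factor C (log (2 + N))ᶜ implicit in ≲.  As ⌊log₂ (2 + N)⌋ ≥ 1, and
-- it agrees with log (2 + N) up to constant factors, neither the choice of
-- logarithm nor restricting C and c to natural numbers affects ≲.

polylog : (C c N : ℕ) → ℕ
polylog C c N = C ℕ.* ⌊log₂ (2 ℕ.+ N) ⌋ ℕ.^ c

{-# OPTIONS --safe #-}

-- A representation z = (a₁ + a₂) / (a₁′ + a₂′) says that the line of slope z
-- through the point (a₁ , a₁′) of A₁ × A₁ is opposite to the one through
-- (a₂ , a₂′) in A₂ × A₂, i.e. a₁ - z a₁′ = - (a₂ - z a₂′).  Consider dyadically
-- the lines with about s points in A₁ × A₁ whose opposites have about t points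
-- in A₂ × A₂.  For each z there are at most |A₁|² / s of them, and by
-- Szemerédi-Trotter the number for all z ∈ Z together is ≲ |A₁|⁴ / s³ as well
-- as ≲ |A₂|⁴ / t³ (for bounded s, t because |Z| ≲ |A₁|²).  Weighting the last
-- two bounds with 1/3 and 2/3, these lines contribute
--   s² t² (|A₁|² / s) (|A₁|⁴ / s³)^(1/3) (|A₂|⁴ / t³)^(2/3) = |A₁|^(10/3) |A₂|^(8/3).
-- For Cartesian products Szemerédi-Trotter has an elementary proof: cut the
-- grid into blocks; a line is monotone, so it meets few blocks, and a rich line
-- has many pairs of points in a common block.
-- Equality and order of the finitely many reals involved are decidable only up
-- to double negation, which is enough since the final inequality is decidable.

module Submission where

open import Defs
open import Data.Nat as ℕ using (ℕ)
import Data.Nat.Properties as ℕₚ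
open import Data.Product using (Σ; ∃; _×_; _,_; proj₁; proj₂)
open import Data.Sum using (_⊎_; inj₁; inj₂; [_,_]′)
open import Function using (_∘_)
open import Relation.Binary.PropositionalEquality
open import Relation.Nullary using (Dec; yes; no; ¬_; ¬?; contradiction)

-- Cauchy sequences and lines over the reals

module Sequences where

  open import Data.Rational hiding (_≃_)
  open import Data.Rational.Properties hiding (≃-sym)
  open import Data.Rational.Solver using (module +-*-Solver)
  open +-*-Solver

  -- Null, positive and bounded sequences of rationals

  Eventually : (ℕ → Set) → Set
  Eventually P = ∃ λ N → ∀ n → N ℕ.≤ n → P n

  eventually-map : ∀ {P Q : ℕ → Set} → (∀ n → P n → Q n) → Eventually P → Eventually Q
  eventually-map f (N , h) = N , λ n N≤n → f n (h n N≤n)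

  eventually-zip : ∀ {P Q R : ℕ → Set} → (∀ n → P n → Q n → R n) →
                   Eventually P → Eventually Q → Eventually R
  eventually-zip f (M , g) (N , h) = M ℕ.⊔ N , λ n M⊔N≤n →
    f n (g n (ℕₚ.m⊔n≤o⇒m≤o M N M⊔N≤n)) (h n (ℕₚ.m⊔n≤o⇒n≤o M N M⊔N≤n))

  Null Pos Neg Bounded : (ℕ → ℚ) → Set
  Null x = ∀ ε → 0ℚ < ε → Eventually λ n → ∣ x n ∣ ≤ ε
  Pos x = Σ ℚ λ δ → 0ℚ < δ × Eventually λ n → δ ≤ x n
  Neg x = Pos (λ n → - x n)
  Bounded x = Σ ℚ λ B → 0ℚ < B × Eventually λ n → ∣ x n ∣ ≤ B

  p≤∣p∣ : ∀ p → p ≤ ∣ p ∣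
  p≤∣p∣ p with ∣p∣≡p∨∣p∣≡-p p
  ... | inj₁ ∣p∣≡p  = ≤-reflexive (sym ∣p∣≡p)
  ... | inj₂ ∣p∣≡-p = ≤-trans (begin
    p          ≡⟨ +-identityʳ p ⟨
    p + 0ℚ     ≤⟨ +-monoʳ-≤ p (0≤∣p∣ p) ⟩
    p + ∣ p ∣  ≡⟨ cong (p +_) ∣p∣≡-p ⟩
    p - p      ≡⟨ +-inverseʳ p ⟩
    0ℚ         ∎) (0≤∣p∣ p)
    where open ≤-Reasoning

  null-cong : ∀ {x y} → (∀ n → x n ≡ y n) → Null x → Null y
  null-cong x≡y null ε 0<ε = eventually-map (λ n → subst (λ t → ∣ t ∣ ≤ ε) (x≡y n)) (null ε 0<ε)

  null-+ : ∀ {x y} → Null x → Null y → Null (λ n → x n + y n)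
  null-+ {x} {y} nx ny ε 0<ε with halve ε 0<ε
  ... | η , 0<η , η+η≡ε = eventually-zip
    (λ n ∣x∣≤η ∣y∣≤η → ≤-trans (∣p+q∣≤∣p∣+∣q∣ (x n) (y n))
      (subst (∣ x n ∣ + ∣ y n ∣ ≤_) η+η≡ε (+-mono-≤ ∣x∣≤η ∣y∣≤η)))
    (nx η 0<η) (ny η 0<η)

  null-neg : ∀ {x} → Null x → Null (λ n → - x n)
  null-neg {x} nx ε 0<ε = eventually-map (λ n → subst (_≤ ε) (sym (∣-p∣≡∣p∣ (x n)))) (nx ε 0<ε)

  null-- : ∀ {x y} → Null x → Null y → Null (λ n → x n - y n)
  null-- nx ny = null-+ nx (null-neg ny)

  null-* : ∀ {x y} → Bounded x → Null y → Null (λ n → x n * y n)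
  null-* {x} {y} (B , 0<B , x≤B) ny ε 0<ε with scale B ε 0<B 0<ε
  ... | η , 0<η , B*η≡ε = eventually-zip
    (λ n ∣x∣≤B ∣y∣≤η → subst (∣ x n * y n ∣ ≤_) B*η≡ε (∣p*q∣≤b*e (x n) (y n) ∣x∣≤B ∣y∣≤η))
    x≤B (ny η 0<η)

  bounded : (x : ℝ) → Bounded (seq x)
  bounded x = eventually-bounded (seq x) (cauchy x)

  pos-cong : ∀ {x y} → (∀ n → x n ≡ y n) → Pos x → Pos y
  pos-cong x≡y (δ , 0<δ , δ≤x) = δ , 0<δ , eventually-map (λ n → subst (δ ≤_) (x≡y n)) δ≤x

  pos-+ : ∀ {x y} → Pos x → Pos y → Pos (λ n → x n + y n)
  pos-+ (δ , 0<δ , δ≤x) (ε , 0<ε , ε≤y) =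
    δ + ε , +-mono-< 0<δ 0<ε , eventually-zip (λ _ → +-mono-≤) δ≤x ε≤y

  pos-* : ∀ {x y} → Pos x → Pos y → Pos (λ n → x n * y n)
  pos-* {x} {y} (δ , 0<δ , δ≤x) (ε , 0<ε , ε≤y) =
    δ * ε , positive⁻¹ (δ * ε) {{pos*pos⇒pos δ {{positive 0<δ}} ε {{positive 0<ε}}}} ,
    eventually-zip (λ n δ≤xn ε≤yn → ≤-trans
      (*-monoˡ-≤-nonNeg δ {{nonNegative (<⇒≤ 0<δ)}} ε≤yn)
      (*-monoʳ-≤-nonNeg (y n) {{nonNegative (≤-trans (<⇒≤ 0<ε) ε≤yn)}} δ≤xn)) δ≤x ε≤y

  pos⇒¬null : ∀ {x} → Pos x → ¬ Null x
  pos⇒¬null {x} (δ , 0<δ , δ≤x) nx with halve δ 0<δ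
  ... | η , 0<η , η+η≡δ with eventually-zip {R = λ _ → δ ≤ η}
          (λ n δ≤xn ∣xn∣≤η → ≤-trans δ≤xn (≤-trans (p≤∣p∣ (x n)) ∣xn∣≤η)) δ≤x (nx η 0<η)
  ... | N , δ≤η = <-irrefl refl (<-≤-trans
            (subst (η <_) η+η≡δ (subst (_< η + η) (+-identityʳ η) (+-monoʳ-< η 0<η)))
            (δ≤η N ℕₚ.≤-refl))

  null-cancel : ∀ {x y} → Pos x → Null (λ n → x n * y n) → Null y
  null-cancel {x} {y} (δ , 0<δ , δ≤x) nxy ε 0<ε = eventually-zip
    (λ n δ≤xn ∣xy∣≤δε → *-cancelˡ-≤-pos δ {{positive 0<δ}} (begin
      δ * ∣ y n ∣        ≤⟨ *-monoʳ-≤-nonNeg ∣ y n ∣ {{∣-∣-nonNeg (y n)}} (≤-trans δ≤xn (p≤∣p∣ (x n))) ⟩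
      ∣ x n ∣ * ∣ y n ∣  ≡⟨ ∣p*q∣≡∣p∣*∣q∣ (x n) (y n) ⟨
      ∣ x n * y n ∣      ≤⟨ ∣xy∣≤δε ⟩
      δ * ε              ∎))
    δ≤x (nxy (δ * ε) (positive⁻¹ (δ * ε) {{pos*pos⇒pos δ {{positive 0<δ}} ε {{positive 0<ε}}}}))
    where open ≤-Reasoning

  -- Past the index from which terms differ by at most `η`, half of `ε`, a single term above `ε`
  -- would keep all the others at least `η` and so make `x` positive. Only rationals are compared.
  ¬pos⇒≤ : ∀ x → IsCauchy x → ¬ Pos x → ∀ ε → 0ℚ < ε → Eventually λ n → x n ≤ ε
  ¬pos⇒≤ x cx ¬pos ε 0<ε with halve ε 0<ε
  ... | η , 0<η , η+η≡ε with cx η 0<η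
  ... | N , close = N , λ n N≤n → ≮⇒≥ λ ε<xn → ¬pos (η , 0<η , N , λ m N≤m → ≮⇒≥ λ xm<η →
    <-irrefl refl (begin-strict
      x n                ≡⟨ split (x n) (x m) ⟩
      x m + (x n - x m)  <⟨ +-mono-<-≤ xm<η (≤-trans (p≤∣p∣ (x n - x m)) (close n m N≤n N≤m)) ⟩
      η + η              ≡⟨ η+η≡ε ⟩
      ε                  <⟨ ε<xn ⟩
      x n                ∎))
    where
    open ≤-Reasoning
    split : ∀ p q → p ≡ q + (p - q)
    split = solve 2 (λ p q → p := q :+ (p :- q)) refl

  neg-cauchy : ∀ x → IsCauchy x → IsCauchy (λ n → - x n)
  neg-cauchy x cx ε 0<ε with cx ε 0<ε
  ... | N , close = N , λ m n N≤m N≤n → subst (_≤ ε) (flip m n) (close m n N≤m N≤n)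
    where
    neg-difference : ∀ p q → - (p - q) ≡ - p - - q
    neg-difference = solve 2 (λ p q → :- (p :- q) := :- p :- (:- q)) refl
    flip : ∀ m n → ∣ x m - x n ∣ ≡ ∣ - x m - - x n ∣
    flip m n = trans (sym (∣-p∣≡∣p∣ (x m - x n))) (cong ∣_∣ (neg-difference (x m) (x n)))

  -- The form of trichotomy that holds without deciding the sign of a real number.
  ¬pos∧¬neg⇒null : ∀ x → IsCauchy x → ¬ Pos x → ¬ Neg x → Null x
  ¬pos∧¬neg⇒null x cx ¬pos ¬neg ε 0<ε = eventually-zip
    (λ n x≤ε -x≤ε → [ (λ eq → subst (_≤ ε) (sym eq) x≤ε) , (λ eq → subst (_≤ ε) (sym eq) -x≤ε) ]′
                      (∣p∣≡p∨∣p∣≡-p (x n)))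
    (¬pos⇒≤ x cx ¬pos ε 0<ε) (¬pos⇒≤ (λ n → - x n) (neg-cauchy x cx) ¬neg ε 0<ε)

  -- Equality, order and lines over the reals

  ≃-sym : ∀ x y → x ≃ y → y ≃ x
  ≃-sym x y x≃y = null-cong (λ n → neg-swap (seq x n) (seq y n)) (null-neg x≃y)
    where
    neg-swap : ∀ p q → - (p - q) ≡ q - p
    neg-swap = solve 2 (λ p q → :- (p :- q) := q :- p) refl

  ≃-trans : ∀ x y z → x ≃ y → y ≃ z → x ≃ z
  ≃-trans x y z x≃y y≃z =
    null-cong (λ n → telescope (seq x n) (seq y n) (seq z n)) (null-+ x≃y y≃z)
    where
    telescope : ∀ p q r → (p - q) + (q - r) ≡ p - r
    telescope = solve 3 (λ p q r → (p :- q) :+ (q :- r) := p :- r) refl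

  infix 4 _⊏_
  _⊏_ : ℝ → ℝ → Set
  x ⊏ y = Pos (λ n → seq y n - seq x n)

  ⊏-trans : ∀ x y z → x ⊏ y → y ⊏ z → x ⊏ z
  ⊏-trans x y z x⊏y y⊏z =
    pos-cong (λ n → telescope (seq x n) (seq y n) (seq z n)) (pos-+ x⊏y y⊏z)
    where
    telescope : ∀ p q r → (q - p) + (r - q) ≡ r - p
    telescope = solve 3 (λ p q r → (q :- p) :+ (r :- q) := r :- p) refl

  ≃⇒¬⊏ : ∀ x y → x ≃ y → ¬ y ⊏ x
  ≃⇒¬⊏ x y x≃y y⊏x = pos⇒¬null y⊏x x≃y

  ≃-refl : ∀ x → x ≃ x
  ≃-refl x ε 0<ε = 0 , λ n _ → subst (λ t → ∣ t ∣ ≤ ε) (sym (+-inverseʳ (seq x n))) (<⇒≤ 0<ε)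

  ⊏-irrefl : ∀ x → ¬ x ⊏ x
  ⊏-irrefl x = ≃⇒¬⊏ x x (≃-refl x)

  ¬⊏∧¬⊐⇒≃ : ∀ x y → ¬ y ⊏ x → ¬ x ⊏ y → x ≃ y
  ¬⊏∧¬⊐⇒≃ x y ¬y⊏x ¬x⊏y =
    ¬pos∧¬neg⇒null (λ n → seq x n - seq y n)
      (+-cauchy (seq x) (λ n → - seq y n) (cauchy x) (neg-cauchy (seq y) (cauchy y)))
      ¬y⊏x (¬x⊏y ∘ pos-cong λ n → neg-swap (seq x n) (seq y n))
    where
    neg-swap : ∀ p q → - (p - q) ≡ q - p
    neg-swap = solve 2 (λ p q → :- (p :- q) := q :- p) refl

  -- The points (a , b) and (a′ , b′) lie on a common line a - z b = const.
  SameLine : (z a b a′ b′ : ℝ) → Set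
  SameLine z a b a′ b′ = Null λ n →
    (seq a n - seq z n * seq b n) - (seq a′ n - seq z n * seq b′ n)

  sameLine-refl : ∀ z a b → SameLine z a b a b
  sameLine-refl z a b ε 0<ε = 0 , λ n _ →
    subst (λ t → ∣ t ∣ ≤ ε) (sym (+-inverseʳ (seq a n - seq z n * seq b n))) (<⇒≤ 0<ε)

  sameLine-sym : ∀ z a b a′ b′ → SameLine z a b a′ b′ → SameLine z a′ b′ a b
  sameLine-sym z a b a′ b′ l = null-cong
    (λ n → neg-swap (seq a n - seq z n * seq b n) (seq a′ n - seq z n * seq b′ n)) (null-neg l)
    where
    neg-swap : ∀ p q → - (p - q) ≡ q - p
    neg-swap = solve 2 (λ p q → :- (p :- q) := q :- p) refl

  sameLine-trans : ∀ z a b a′ b′ a″ b″ →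
    SameLine z a b a′ b′ → SameLine z a′ b′ a″ b″ → SameLine z a b a″ b″
  sameLine-trans z a b a′ b′ a″ b″ l l′ = null-cong
    (λ n → telescope (seq a n - seq z n * seq b n) (seq a′ n - seq z n * seq b′ n)
                     (seq a″ n - seq z n * seq b″ n)) (null-+ l l′)
    where
    telescope : ∀ p q r → (p - q) + (q - r) ≡ p - r
    telescope = solve 3 (λ p q r → (p :- q) :+ (q :- r) := p :- r) refl

  sameLine-row : ∀ z a b a′ → SameLine z a b a′ b → a ≃ a′
  sameLine-row z a b a′ = null-cong λ n → cancel (seq z n) (seq a n) (seq b n) (seq a′ n)
    where
    cancel : ∀ z a b a′ → (a - z * b) - (a′ - z * b) ≡ a - a′
    cancel = solve 4 (λ z a b a′ → (a :- z :* b) :- (a′ :- z :* b) := a :- a′) refl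

  -- Subtracting the two line equations leaves `(b′ - b) * (z - z′)`, whose first factor is positive
  -- and cancels.
  sameLine-slope : ∀ z z′ a b a′ b′ → b ⊏ b′ →
    SameLine z a b a′ b′ → SameLine z′ a b a′ b′ → z ≃ z′
  sameLine-slope z z′ a b a′ b′ b⊏b′ l l′ = null-cancel b⊏b′
    (null-cong (λ n → difference (seq z n) (seq z′ n) (seq a n) (seq b n) (seq a′ n) (seq b′ n))
               (null-- l l′))
    where
    difference : ∀ z z′ a b a′ b′ →
      ((a - z * b) - (a′ - z * b′)) - ((a - z′ * b) - (a′ - z′ * b′)) ≡ (b′ - b) * (z - z′)
    difference = solve 6 (λ z z′ a b a′ b′ →
      ((a :- z :* b) :- (a′ :- z :* b′)) :- ((a :- z′ :* b) :- (a′ :- z′ :* b′)) :=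
      (b′ :- b) :* (z :- z′)) refl

  -- Otherwise the difference of the two values of a - z b would be the sum
  -- `(a - a′) + z * (b′ - b)` of positive terms, which is not null.
  sameLine-pos : ∀ z a b a′ b′ → Pos (seq z) → SameLine z a b a′ b′ → a′ ⊏ a → ¬ b ⊏ b′
  sameLine-pos z a b a′ b′ 0⊏z l a′⊏a b⊏b′ = pos⇒¬null
    (pos-cong (λ n → regroup (seq z n) (seq a n) (seq b n) (seq a′ n) (seq b′ n))
              (pos-+ a′⊏a (pos-* 0⊏z b⊏b′))) l
    where
    regroup : ∀ z a b a′ b′ → (a - a′) + z * (b′ - b) ≡ (a - z * b) - (a′ - z * b′)
    regroup = solve 5 (λ z a b a′ b′ →
      (a :- a′) :+ z :* (b′ :- b) := (a :- z :* b) :- (a′ :- z :* b′)) refl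

  sameLine-neg : ∀ z a b a′ b′ → Neg (seq z) → SameLine z a b a′ b′ → a′ ⊏ a → ¬ b′ ⊏ b
  sameLine-neg z a b a′ b′ z⊏0 l a′⊏a b′⊏b = pos⇒¬null
    (pos-cong (λ n → regroup (seq z n) (seq a n) (seq b n) (seq a′ n) (seq b′ n))
              (pos-+ a′⊏a (pos-* z⊏0 b′⊏b))) l
    where
    regroup : ∀ z a b a′ b′ → (a - a′) + (- z) * (b - b′) ≡ (a - z * b) - (a′ - z * b′)
    regroup = solve 5 (λ z a b a′ b′ →
      (a :- a′) :+ (:- z) :* (b :- b′) := (a :- z :* b) :- (a′ :- z :* b′)) refl

  -- The sequences of `b` and `b′` are eventually bounded, so their products with `z` are null.
  sameLine-zero : ∀ z a b a′ b′ → Null (seq z) → SameLine z a b a′ b′ → a ≃ a′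
  sameLine-zero z a b a′ b′ z≃0 l = null-cong
    (λ n → regroup (seq z n) (seq a n) (seq b n) (seq a′ n) (seq b′ n))
    (null-+ l (null-- (null-* (bounded b) z≃0) (null-* (bounded b′) z≃0)))
    where
    regroup : ∀ z a b a′ b′ → ((a - z * b) - (a′ - z * b′)) + (b * z - b′ * z) ≡ a - a′
    regroup = solve 5 (λ z a b a′ b′ →
      ((a :- z :* b) :- (a′ :- z :* b′)) :+ (b :* z :- b′ :* z) := a :- a′) refl

  -- Opposite lines and the equation of a quotient

  OppositeLines : (z a b c d : ℝ) → Set
  OppositeLines z a b c d = Null λ n →
    (seq a n - seq z n * seq b n) + (seq c n - seq z n * seq d n)

  opposite⇒sameLine₁ : ∀ z a b a′ b′ c d →
    OppositeLines z a b c d → OppositeLines z a′ b′ c d → SameLine z a b a′ b′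
  opposite⇒sameLine₁ z a b a′ b′ c d o o′ = null-cong
    (λ n → cancel (seq a n - seq z n * seq b n) (seq a′ n - seq z n * seq b′ n)
                  (seq c n - seq z n * seq d n)) (null-- o o′)
    where
    cancel : ∀ p q r → (p + r) - (q + r) ≡ p - q
    cancel = solve 3 (λ p q r → (p :+ r) :- (q :+ r) := p :- q) refl

  opposite⇒sameLine₂ : ∀ z a b c d c′ d′ →
    OppositeLines z a b c d → OppositeLines z a b c′ d′ → SameLine z c d c′ d′
  opposite⇒sameLine₂ z a b c d c′ d′ o o′ = null-cong
    (λ n → cancel (seq c n - seq z n * seq d n) (seq c′ n - seq z n * seq d′ n)
                  (seq a n - seq z n * seq b n)) (null-- o o′)
    where
    cancel : ∀ p q r → (r + p) - (r + q) ≡ p - q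
    cancel = solve 3 (λ p q r → (r :+ p) :- (r :+ q) := p :- q) refl

  -- The terms of the inverse are taken at the shifted index `N + n`, so the product is 1 only up to
  -- the effect of the shift. This is null because `y` is Cauchy and its inverse is bounded.
  inverse-inverse : ∀ y (nz : y ≄0) → Null λ n → seq (inverse y nz) n * seq y n - 1ℚ
  inverse-inverse y nz@(δ , 0<δ , N , δ≤∣y∣) = null-cong shift
    (null-* (bounded (inverse y nz)) tail-null)
    where
    y⁻¹ : ℕ → ℚ
    y⁻¹ = seq (inverse y nz)
    tail-null : Null λ n → seq y n - seq y (N ℕ.+ n)
    tail-null ε 0<ε with cauchy y ε 0<ε
    ... | M , close = M , λ n M≤n → close n (N ℕ.+ n) M≤n (ℕₚ.≤-trans M≤n (ℕₚ.m≤n+m n N))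
    distrib : ∀ i p q → i * (p - q) ≡ i * p - i * q
    distrib = solve 3 (λ i p q → i :* (p :- q) := i :* p :- i :* q) refl
    shift : ∀ n → y⁻¹ n * (seq y n - seq y (N ℕ.+ n)) ≡ y⁻¹ n * seq y n - 1ℚ
    shift n = trans (distrib (y⁻¹ n) (seq y n) (seq y (N ℕ.+ n)))
      (cong (λ t → y⁻¹ n * seq y n - t) (*-inverseˡ (seq y (N ℕ.+ n))
        {{apart⇒nonZero (seq y (N ℕ.+ n)) 0<δ (δ≤∣y∣ (N ℕ.+ n) (ℕₚ.m≤m+n N n))}}))

  -- Clearing the denominator turns (a + c) / (b + d) = z into (a - z b) + (c - z d) = 0. The null
  -- error of the inverse enters multiplied by the bounded `a ⊕ c`.
  quotient⇒opposite : ∀ z a b c d (nz : b ⊕ d ≄0) →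
    quotient (a ⊕ c) (b ⊕ d) nz ≃ z → OppositeLines z a b c d
  quotient⇒opposite z a b c d nz eq = null-cong
    (λ n → regroup (seq z n) (seq a n) (seq b n) (seq c n) (seq d n) (seq (inverse (b ⊕ d) nz) n))
    (null-- (null-* (bounded (b ⊕ d)) eq) (null-* (bounded (a ⊕ c)) (inverse-inverse (b ⊕ d) nz)))
    where
    -- The identity is proved with a variable `e` in place of 1 and then specialised to `1ℚ`.
    regroup′ : ∀ e z a b c d i →
      (b + d) * ((a + c) * i - z) - (a + c) * (i * (b + d) - e) ≡ (a + c) * e - z * (b + d)
    regroup′ = solve 7 (λ e z a b c d i →
      (b :+ d) :* ((a :+ c) :* i :- z) :- (a :+ c) :* (i :* (b :+ d) :- e) :=
      (a :+ c) :* e :- z :* (b :+ d)) refl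
    split : ∀ z a b c d → (a + c) - z * (b + d) ≡ (a - z * b) + (c - z * d)
    split = solve 5 (λ z a b c d → (a :+ c) :- z :* (b :+ d) := (a :- z :* b) :+ (c :- z :* d)) refl
    regroup : ∀ z a b c d i →
      (b + d) * ((a + c) * i - z) - (a + c) * (i * (b + d) - 1ℚ) ≡ (a - z * b) + (c - z * d)
    regroup z a b c d i = trans (regroup′ 1ℚ z a b c d i)
      (trans (cong (_- z * (b + d)) (*-identityʳ (a + c))) (split z a b c d))

open Sequences
open import Algebra.Properties.Semiring.Sum ℕₚ.+-*-semiring
  using (sum; sum-syntax; sum-cong-≗; ∑-comm; ∑-distrib-+; *-distribˡ-sum; *-distribʳ-sum)
open import Data.Fin using (Fin; zero; suc; toℕ; fromℕ; fromℕ<; inject₁; combine; remQuot; _↑ˡ_; _↑ʳ_)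
import Data.Fin.Properties as Fin
open import Data.Nat
open import Data.Nat.DivMod
open import Data.Nat.Logarithm using (⌊log₂_⌋; ⌊log₂⌋-mono-≤; ⌊log₂[2^n]⌋≡n)
open import Data.Nat.Properties
open import Data.Nat.Tactic.RingSolver using (solve-∀)
open import Data.Unit using (⊤; tt)
open import Effect.Monad using (RawMonad)
open import Level using (0ℓ)
open import Relation.Nullary.Decidable using (_×-dec_; toWitness; ¬¬-excluded-middle; decidable-stable)
open import Relation.Nullary.Negation using (¬¬-Monad)
open import Relation.Unary using (Decidable)

-- Counting over finite index sets

𝟙 : ∀ {P : Set} → Dec P → ℕ
𝟙 (yes _) = 1
𝟙 (no _)  = 0

𝟙-mono : ∀ {P Q : Set} (P? : Dec P) (Q? : Dec Q) → (P → Q) → 𝟙 P? ≤ 𝟙 Q?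
𝟙-mono (no _)  _       _ = z≤n
𝟙-mono (yes _) (yes _) _ = ≤-refl
𝟙-mono (yes p) (no ¬q) f = contradiction (f p) ¬q

𝟙≤ : ∀ {P : Set} (P? : Dec P) {c} → (P → 1 ≤ c) → 𝟙 P? ≤ c
𝟙≤ (yes p) f = f p
𝟙≤ (no _)  _ = z≤n

1≤𝟙 : ∀ {P : Set} (P? : Dec P) → P → 1 ≤ 𝟙 P?
1≤𝟙 (yes _) _ = ≤-refl
1≤𝟙 (no ¬p) p = contradiction p ¬p

𝟙*≤ : ∀ {P : Set} (P? : Dec P) {a c} → (P → a ≤ c) → 𝟙 P? * a ≤ c
𝟙*≤ (yes p) {a} f = ≤-trans (≤-reflexive (*-identityˡ a)) (f p)
𝟙*≤ (no _)      _ = z≤n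

≤*𝟙 : ∀ {P : Set} (P? : Dec P) {a c} → (P → a ≤ c) → (¬ P → a ≤ 0) → a ≤ c * 𝟙 P?
≤*𝟙 (yes p) {a} {c} f _ = ≤-trans (f p) (≤-reflexive (sym (*-identityʳ c)))
≤*𝟙 (no ¬p)         _ g = ≤-trans (g ¬p) z≤n

sum-mono : ∀ {n} {f g : Fin n → ℕ} → (∀ i → f i ≤ g i) → sum f ≤ sum g
sum-mono {zero}  f≤g = z≤n
sum-mono {suc n} f≤g = +-mono-≤ (f≤g zero) (sum-mono (f≤g ∘ suc))

sum-mono-< : ∀ {n} {f g : Fin n → ℕ} → (∀ i → f i ≤ g i) → ∀ i → f i < g i → sum f < sum g
sum-mono-< f≤g zero    fi<gi = +-mono-<-≤ fi<gi (sum-mono (f≤g ∘ suc))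
sum-mono-< f≤g (suc i) fi<gi = +-mono-≤-< (f≤g zero) (sum-mono-< (f≤g ∘ suc) i fi<gi)

sum-const : ∀ n c → sum {n} (λ _ → c) ≡ n * c
sum-const zero    c = refl
sum-const (suc n) c = cong (c +_) (sum-const n c)

sum≤ : ∀ {n c} {f : Fin n → ℕ} → (∀ i → f i ≤ c) → sum f ≤ n * c
sum≤ {n} {c} f≤c = ≤-trans (sum-mono f≤c) (≤-reflexive (sum-const n c))

term≤sum : ∀ {n} (f : Fin n → ℕ) i → f i ≤ sum f
term≤sum f zero    = m≤m+n _ _
term≤sum f (suc i) = ≤-trans (term≤sum (f ∘ suc) i) (m≤n+m _ _)

sum≤max : ∀ {n} .{{_ : NonZero n}} (f : Fin n → ℕ) → ∃ λ i → sum f ≤ n * f i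
sum≤max {suc zero}    f = zero , ≤-refl
sum≤max {suc (suc n)} f with sum≤max (f ∘ suc)
... | i , h with ≤-total (f zero) (f (suc i))
... | inj₁ f0≤fi = suc i , +-mono-≤ f0≤fi h
... | inj₂ fi≤f0 = zero , +-monoʳ-≤ (f zero) (≤-trans h (*-monoʳ-≤ (suc n) fi≤f0))

sum-↑ : ∀ m {n} (f : Fin (m + n) → ℕ) → sum f ≡ sum (f ∘ (_↑ˡ n)) + sum (f ∘ (m ↑ʳ_))
sum-↑ zero    f = refl
sum-↑ (suc m) f = trans (cong (f zero +_) (sum-↑ m (f ∘ suc))) (sym (+-assoc (f zero) _ _))

sum-combine : ∀ m {n} (f : Fin (m * n) → ℕ) → sum f ≡ ∑[ i < m ] ∑[ j < n ] f (combine i j)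
sum-combine zero        f = refl
sum-combine (suc m) {n} f =
  trans (sum-↑ n f) (cong (sum (f ∘ (_↑ˡ (m * n))) +_) (sum-combine m (f ∘ (n ↑ʳ_))))

sum-remQuot : ∀ m {n} (f : Fin m × Fin n → ℕ) →
              sum (f ∘ remQuot {m} n) ≡ ∑[ i < m ] ∑[ j < n ] f (i , j)
sum-remQuot m {n} f = trans (sum-combine m (f ∘ remQuot n))
  (sum-cong-≗ λ i → sum-cong-≗ λ j → cong f (Fin.remQuot-combine i j))

count : ∀ {n} {P : Fin n → Set} → Decidable P → ℕ
count {n} P? = ∑[ i < n ] 𝟙 (P? i)

1≤count : ∀ {n} {P : Fin n → Set} (P? : Decidable P) i → P i → 1 ≤ count P?
1≤count P? i p = ≤-trans (1≤𝟙 (P? i) p) (term≤sum (λ j → 𝟙 (P? j)) i)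

count≤1 : ∀ {n} {P : Fin n → Set} (P? : Decidable P) →
          (∀ {i j} → P i → P j → i ≡ j) → count P? ≤ 1
count≤1 {zero}  P? uniq = z≤n
count≤1 {suc n} P? uniq with P? zero
... | no _  = count≤1 (P? ∘ suc) λ p q → Fin.suc-injective (uniq p q)
... | yes p = s≤s (≤-trans (sum≤ {c = 0} λ i → 𝟙≤ (P? (suc i)) λ q → contradiction (uniq p q) Fin.0≢1+n)
                           (≤-reflexive (*-zeroʳ n)))

-- Double counting along the fibres of `f`: each fibre contains at most one index satisfying `P`,
-- and the weight `h` of its base point pays for it.
count≤sum : ∀ {n m} {P : Fin n → Set} (P? : Decidable P) (f : Fin n → Fin m) (h : Fin m → ℕ) →
            (∀ {i j} → P i → P j → f i ≡ f j → i ≡ j) →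
            (∀ {i} → P i → 1 ≤ h (f i)) → count P? ≤ sum h
count≤sum {n} {m} {P} P? f h inj h≥1 = begin
  ∑[ i < n ] 𝟙 (P? i)                        ≤⟨ sum-mono hit ⟩
  ∑[ i < n ] ∑[ y < m ] (𝟙 (Q? y i) * h y)     ≡⟨ ∑-comm (λ i y → 𝟙 (Q? y i) * h y) ⟩
  ∑[ y < m ] ∑[ i < n ] (𝟙 (Q? y i) * h y)     ≡⟨ sum-cong-≗ (λ y → *-distribʳ-sum (h y) (λ i → 𝟙 (Q? y i))) ⟨
  ∑[ y < m ] (count (Q? y) * h y)            ≤⟨ sum-mono (λ y → *-monoˡ-≤ (h y) (count≤1 (Q? y) unique)) ⟩
  ∑[ y < m ] (1 * h y)                       ≡⟨ sum-cong-≗ (λ y → *-identityˡ (h y)) ⟩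
  sum h                                      ∎
  where
  open ≤-Reasoning
  Q? : ∀ y → Decidable (λ i → P i × f i ≡ y)
  Q? y i = P? i ×-dec (f i Fin.≟ y)
  unique : ∀ {y i j} → P i × f i ≡ y → P j × f j ≡ y → i ≡ j
  unique (p , fi≡y) (q , fj≡y) = inj p q (trans fi≡y (sym fj≡y))
  hit : ∀ i → 𝟙 (P? i) ≤ ∑[ y < m ] (𝟙 (Q? y i) * h y)
  hit i = 𝟙≤ (P? i) λ p → ≤-trans (*-mono-≤ (1≤𝟙 (Q? (f i) i) (p , refl)) (h≥1 p))
                                   (term≤sum (λ y → 𝟙 (Q? y i) * h y) (f i))

count≤size : ∀ {n m} {P : Fin n → Set} (P? : Decidable P) (f : Fin n → Fin m) →
             (∀ {i j} → P i → P j → f i ≡ f j → i ≡ j) → count P? ≤ m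
count≤size {m = m} P? f inj = begin
  count P?             ≤⟨ count≤sum P? f (λ _ → 1) inj (λ _ → ≤-refl) ⟩
  sum {m} (λ _ → 1)    ≡⟨ sum-const m 1 ⟩
  m * 1                ≡⟨ *-identityʳ m ⟩
  m                    ∎
  where open ≤-Reasoning

-- Dyadic decomposition

Dyadic : ℕ → ℕ → Set
Dyadic j x = 2 ^ j ≤ x × x < 2 ^ suc j

dyadic? : ∀ j x → Dec (Dyadic j x)
dyadic? j x = 2 ^ j ≤? x ×-dec x <? 2 ^ suc j

dyadic-class : ∀ J x → 1 ≤ x → x < 2 ^ J → ∃ λ (j : Fin J) → Dyadic (toℕ j) x
dyadic-class zero    x 1≤x x<1 = contradiction (<-≤-trans x<1 1≤x) (<-irrefl refl)
dyadic-class (suc J) x 1≤x x<2 with 2 ^ J ≤? x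
... | yes 2^J≤x = fromℕ J , subst (λ j → Dyadic j x) (sym (Fin.toℕ-fromℕ J)) (2^J≤x , x<2)
... | no  x<2^J with dyadic-class J x 1≤x (≰⇒> x<2^J)
... | j , d = inject₁ j , subst (λ i → Dyadic i x) (sym (Fin.toℕ-inject₁ j)) d

n<2^⌊log₂n⌋+1 : ∀ n → n < 2 ^ suc ⌊log₂ n ⌋
n<2^⌊log₂n⌋+1 n = ≰⇒> λ h → <-irrefl refl
  (subst (_≤ ⌊log₂ n ⌋) (⌊log₂[2^n]⌋≡n (suc ⌊log₂ n ⌋)) (⌊log₂⌋-mono-≤ h))

-- Rich lines in a grid

-- Serves to recover both coordinates of a block from their sum when they move in the same
-- direction.
+-cancel-both : ∀ {a b c d} → a ≤ c → b ≤ d → a + b ≡ c + d → a ≡ c × b ≡ d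
+-cancel-both {a} {b} {c} {d} a≤c b≤d eq =
  ≤-antisym a≤c (+-cancelʳ-≤ b c a (≤-trans (+-monoʳ-≤ c b≤d) (≤-reflexive (sym eq)))) ,
  ≤-antisym b≤d (+-cancelˡ-≤ a d b (≤-trans (+-monoˡ-≤ d a≤c) (≤-reflexive (sym eq))))

column row : ∀ {k} → Fin (k * k) → Fin k
column {k} p = proj₁ (remQuot {k} k p)
row    {k} p = proj₂ (remQuot {k} k p)

grid-ext : ∀ {k} {p p′ : Fin (k * k)} → column {k} p ≡ column {k} p′ → row {k} p ≡ row {k} p′ → p ≡ p′
grid-ext {k} {p} {p′} c r = trans (sym (Fin.combine-remQuot {k} k p))
  (trans (cong₂ combine c r) (Fin.combine-remQuot {k} k p′))

-- The lines of q slopes through the points of a k × k grid.  Only the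
-- order of the coordinates is retained, through rank.
record Lines (q k : ℕ) : Set₁ where
  field
    Collinear   : Fin q → Fin (k * k) → Fin (k * k) → Set
    collinear?  : ∀ w p p′ → Dec (Collinear w p p′)
    c-refl      : ∀ {w p} → Collinear w p p
    c-sym       : ∀ {w p p′} → Collinear w p p′ → Collinear w p′ p
    c-trans     : ∀ {w p p′ p″} → Collinear w p p′ → Collinear w p′ p″ → Collinear w p p″
    row-unique  : ∀ {w p p′} → Collinear w p p′ → row {k} p ≡ row {k} p′ → p ≡ p′
    slope-unique : ∀ {w w′ p p′} → p ≢ p′ → Collinear w p p′ → Collinear w′ p p′ → w ≡ w′
    rank        : Fin k → Fin k
    rank-injective : ∀ {i j} → rank i ≡ rank j → i ≡ j
    monotone    : ∀ w →
      (∀ {p p′} → Collinear w p p′ → toℕ (rank (row {k} p)) ≤ toℕ (rank (row {k} p′)) →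
                  toℕ (rank (column {k} p)) ≤ toℕ (rank (column {k} p′))) ⊎
      (∀ {p p′} → Collinear w p p′ → toℕ (rank (row {k} p)) ≤ toℕ (rank (row {k} p′)) →
                  toℕ (rank (column {k} p′)) ≤ toℕ (rank (column {k} p)))

  richness : Fin q → Fin (k * k) → ℕ
  richness w p = count (collinear? w p)

  rich? : ∀ s w p → Dec (s ≤ richness w p)
  rich? s w p = s ≤? richness w p

  -- A line is counted once for each of its points. The Szemerédi-Trotter bound k⁴ / s³ for the
  -- number of lines therefore takes the form k⁴ / s² here.
  #rich : ℕ → ℕ
  #rich s = ∑[ w < q ] count (rich? s w)

  richness-mono : ∀ {w p p′} → Collinear w p p′ → richness w p ≤ richness w p′
  richness-mono {w} {p} {p′} c =
    sum-mono λ x → 𝟙-mono (collinear? w p x) (collinear? w p′ x) (c-trans (c-sym c))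

  1≤richness : ∀ w p → 1 ≤ richness w p
  1≤richness w p = 1≤count (collinear? w p) p c-refl

  richness≤k : ∀ w p → richness w p ≤ k
  richness≤k w p = count≤size (collinear? w p) (row {k}) λ c c′ → row-unique (c-trans (c-sym c) c′)

-- Szemerédi-Trotter for a grid by cutting it into blocks

module Blocks {q k} (L : Lines q k) (s : ℕ) (4≤s : 4 ≤ s) (s≤k : s ≤ k) where
  open Lines L

  instance
    s≢0 : NonZero s
    s≢0 = >-nonZero (≤-trans (s≤s z≤n) 4≤s)

  -- The side of a block and the largest index of a block along an axis. The side exceeds 8k / s, so
  -- that a line with s points, being monotone, meets at most about s / 4 blocks.
  b R : ℕ
  b = suc (8 * k / s)
  R = s / 8

  8k≤b*s : 8 * k ≤ b * s
  8k≤b*s = begin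
    8 * k                            ≡⟨ m≡m%n+[m/n]*n (8 * k) s ⟩
    8 * k % s + 8 * k / s * s        ≤⟨ +-monoˡ-≤ _ (<⇒≤ (m%n<n (8 * k) s)) ⟩
    s + 8 * k / s * s                ∎
    where open ≤-Reasoning

  b*s≤9k : b * s ≤ 9 * k
  b*s≤9k = +-mono-≤ s≤k (m/n*n≤m (8 * k) s)

  cell : Fin k → ℕ
  cell i = toℕ (rank i) / b

  cell≤R : ∀ i → cell i ≤ R
  cell≤R i = subst (_≤ R) (m*n/n≡m (cell i) 8) (/-monoˡ-≤ 8 (*-cancelʳ-≤ (cell i * 8) s b (begin
    cell i * 8 * b        ≡⟨ rearrange (cell i) b ⟩
    8 * (cell i * b)      ≤⟨ *-monoʳ-≤ 8 (m/n*n≤m (toℕ (rank i)) b) ⟩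
    8 * toℕ (rank i)      ≤⟨ *-monoʳ-≤ 8 (<⇒≤ (Fin.toℕ<n (rank i))) ⟩
    8 * k                 ≤⟨ 8k≤b*s ⟩
    b * s                 ≡⟨ *-comm b s ⟩
    s * b                 ∎)))
    where
    open ≤-Reasoning
    rearrange : ∀ x y → x * 8 * y ≡ 8 * (x * y)
    rearrange = solve-∀

  #colours : ℕ
  #colours = suc (R + R)

  -- A line with s points thus has on average at least two points per colour. The choice of 8 and
  -- the assumption `4≤s` enter here: 2 (2 + 4R) = 4 + 8R is at most s + s.
  2#colours≤s : 2 * #colours ≤ s
  2#colours≤s = *-cancelˡ-≤ 2 (begin
    2 * (2 * #colours)   ≡⟨ rearrange R ⟩
    4 + R * 8            ≤⟨ +-mono-≤ 4≤s (m/n*n≤m s 8) ⟩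
    s + s                ≡⟨ cong (s +_) (+-identityʳ s) ⟨
    2 * s                ∎)
    where
    open ≤-Reasoning
    rearrange : ∀ x → 2 * (2 * suc (x + x)) ≡ 4 + x * 8
    rearrange = solve-∀

  -- The blocks met by a line form a chain, so the colour determines the block.
  colour : Fin q → Fin (k * k) → ℕ
  colour w p with monotone w
  ... | inj₁ _ = cell (column {k} p) + cell (row {k} p)
  ... | inj₂ _ = cell (column {k} p) + (R ∸ cell (row {k} p))

  colour< : ∀ w p → colour w p < #colours
  colour< w p with monotone w
  ... | inj₁ _ = s≤s (+-mono-≤ (cell≤R (column {k} p)) (cell≤R (row {k} p)))
  ... | inj₂ _ = s≤s (+-mono-≤ (cell≤R (column {k} p)) (m∸n≤m R (cell (row {k} p))))

  SameBlock : Fin (k * k) → Fin (k * k) → Set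
  SameBlock p p′ = cell (column {k} p) ≡ cell (column {k} p′) × cell (row {k} p) ≡ cell (row {k} p′)

  -- Both summands of the colour move in the same direction along the line, so equal sums have equal
  -- summands. On a decreasing line the row enters through `R ∸_`, which is injective on cells
  -- because they are at most `R`.
  colour⇒block-≤ : ∀ {w p p′} → Collinear w p p′ → toℕ (rank (row {k} p)) ≤ toℕ (rank (row {k} p′)) →
                   colour w p ≡ colour w p′ → SameBlock p p′
  colour⇒block-≤ {w} {p} {p′} c le eq with monotone w
  ... | inj₁ mono = +-cancel-both (/-monoˡ-≤ b (mono c le)) (/-monoˡ-≤ b le) eq
  ... | inj₂ anti with +-cancel-both (/-monoˡ-≤ b (anti c le)) (∸-monoʳ-≤ R (/-monoˡ-≤ b le)) (sym eq)
  ... | x≡ , y≡ = sym x≡ , ∸-cancelˡ-≡ (cell≤R (row {k} p)) (cell≤R (row {k} p′)) (sym y≡)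

  colour⇒block : ∀ {w p p′} → Collinear w p p′ → colour w p ≡ colour w p′ → SameBlock p p′
  colour⇒block {w} {p} {p′} c eq with ≤-total (toℕ (rank (row {k} p))) (toℕ (rank (row {k} p′)))
  ... | inj₁ le = colour⇒block-≤ c le eq
  ... | inj₂ ge with colour⇒block-≤ (c-sym c) ge (sym eq)
  ... | x≡ , y≡ = sym x≡ , sym y≡

  -- For collinear points equal colours mean a common block, by `colour⇒block`.
  Neighbour : Fin q → Fin (k * k) → Fin (k * k) → Set
  Neighbour w p p′ = p ≢ p′ × Collinear w p p′ × colour w p ≡ colour w p′

  neighbour? : ∀ w p p′ → Dec (Neighbour w p p′)
  neighbour? w p p′ = ¬? (p Fin.≟ p′) ×-dec collinear? w p p′ ×-dec colour w p ≟ colour w p′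

  accompanied? : ∀ w p → Dec (∃ (Neighbour w p))
  accompanied? w p = Fin.any? (neighbour? w p)

  lonely? : ∀ w p → Dec (s ≤ richness w p × ¬ ∃ (Neighbour w p))
  lonely? w p = rich? s w p ×-dec ¬? (accompanied? w p)

  -- Distinct lonely points of one line differ in colour, since otherwise they would be neighbours.
  -- A line that is not rich carries no lonely points.
  lonely-on-line : ∀ w p′ →
    count (λ p → lonely? w p ×-dec collinear? w p p′) ≤ #colours * 𝟙 (rich? s w p′)
  lonely-on-line w p′ = ≤*𝟙 (rich? s w p′)
    (λ _ → count≤size _ (λ p → fromℕ< (colour< w p)) λ {p₁} {p₂} → colour-injective p₁ p₂)
    (λ ¬rich → ≤-trans (sum≤ λ p → 𝟙≤ (lonely? w p ×-dec collinear? w p p′)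
                          λ ((rich , _) , c) → contradiction (≤-trans rich (richness-mono c)) ¬rich)
                        (≤-reflexive (*-zeroʳ (k * k))))
    where
    colour-injective : ∀ p₁ p₂ → (s ≤ richness w p₁ × ¬ ∃ (Neighbour w p₁)) × Collinear w p₁ p′ →
                (s ≤ richness w p₂ × ¬ ∃ (Neighbour w p₂)) × Collinear w p₂ p′ →
                fromℕ< (colour< w p₁) ≡ fromℕ< (colour< w p₂) → p₁ ≡ p₂
    colour-injective p₁ p₂ ((_ , alone) , c₁) (_ , c₂) eq with p₁ Fin.≟ p₂
    ... | yes p₁≡p₂ = p₁≡p₂
    ... | no  p₁≢p₂ = contradiction (p₂ , p₁≢p₂ , c-trans c₁ (c-sym c₂) ,
                                     Fin.fromℕ<-injective _ _ (colour< w p₁) (colour< w p₂) eq) alone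

  -- Double counting of the pairs of a lonely `p` and a point `p′` of its line: each `p` is in at
  -- least `s` pairs, each rich `p′` in at most `#colours`, any other `p′` in none.
  few-lonely : ∀ w → s * count (lonely? w) ≤ #colours * count (rich? s w)
  few-lonely w = begin
    s * count (lonely? w)
      ≡⟨ *-distribˡ-sum s (λ p → 𝟙 (lonely? w p)) ⟩
    ∑[ p < k * k ] (s * 𝟙 (lonely? w p))
      ≤⟨ sum-mono many ⟩
    ∑[ p < k * k ] ∑[ p′ < k * k ] 𝟙 (lonely? w p ×-dec collinear? w p p′)
      ≡⟨ ∑-comm (λ p p′ → 𝟙 (lonely? w p ×-dec collinear? w p p′)) ⟩
    ∑[ p′ < k * k ] ∑[ p < k * k ] 𝟙 (lonely? w p ×-dec collinear? w p p′)
      ≤⟨ sum-mono (lonely-on-line w) ⟩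
    ∑[ p′ < k * k ] (#colours * 𝟙 (rich? s w p′))
      ≡⟨ *-distribˡ-sum #colours (λ p′ → 𝟙 (rich? s w p′)) ⟨
    #colours * count (rich? s w) ∎
    where
    open ≤-Reasoning
    many : ∀ p → s * 𝟙 (lonely? w p) ≤ ∑[ p′ < k * k ] 𝟙 (lonely? w p ×-dec collinear? w p p′)
    many p = ≤-trans (≤-reflexive (*-comm s _)) (𝟙*≤ (lonely? w p) λ l → ≤-trans (proj₁ l)
      (sum-mono λ p′ → 𝟙-mono (collinear? w p p′) (lonely? w p ×-dec collinear? w p p′) (l ,_)))

  -- A rich point is accompanied or lonely, and by `few-lonely` and `2#colours≤s` at most half of
  -- the rich points are lonely.
  half-accompanied : ∀ w → count (rich? s w) ≤ 2 * count (accompanied? w)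
  half-accompanied w = +-cancelˡ-≤ G G (2 * A) (begin
    G + G                  ≤⟨ +-mono-≤ split split ⟩
    (A + B) + (A + B)      ≡⟨ rearrange A B ⟩
    2 * B + 2 * A          ≤⟨ +-monoˡ-≤ (2 * A) (*-cancelˡ-≤ s 2B≤G) ⟩
    G + 2 * A              ∎)
    where
    open ≤-Reasoning
    G = count (rich? s w)
    A = count (accompanied? w)
    B = count (lonely? w)
    rearrange : ∀ x y → (x + y) + (x + y) ≡ 2 * y + 2 * x
    rearrange = solve-∀
    swap : ∀ x y z → x * (y * z) ≡ y * (x * z)
    swap = solve-∀
    2B≤G : s * (2 * B) ≤ s * G
    2B≤G = begin
      s * (2 * B)          ≡⟨ swap s 2 B ⟩
      2 * (s * B)          ≤⟨ *-monoʳ-≤ 2 (few-lonely w) ⟩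
      2 * (#colours * G)   ≡⟨ *-assoc 2 #colours G ⟨
      2 * #colours * G     ≤⟨ *-monoˡ-≤ G 2#colours≤s ⟩
      s * G                ∎
    split₁ : ∀ p → 𝟙 (rich? s w p) ≤ 𝟙 (accompanied? w p) + 𝟙 (lonely? w p)
    split₁ p = 𝟙≤ (rich? s w p) λ rich → cases rich (accompanied? w p)
      where
      cases : s ≤ richness w p → Dec (∃ (Neighbour w p)) →
              1 ≤ 𝟙 (accompanied? w p) + 𝟙 (lonely? w p)
      cases _    (yes a) = ≤-trans (1≤𝟙 (accompanied? w p) a) (m≤m+n _ _)
      cases rich (no ¬a) = ≤-trans (1≤𝟙 (lonely? w p) (rich , ¬a)) (m≤n+m _ _)
    split : G ≤ A + B
    split = ≤-trans (sum-mono split₁) (≤-reflexive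
      (∑-distrib-+ (λ p → 𝟙 (accompanied? w p)) (λ p → 𝟙 (lonely? w p))))

  sameBlock? : ∀ p p′ → Dec (SameBlock p p′)
  sameBlock? p p′ = cell (column {k} p) ≟ cell (column {k} p′) ×-dec cell (row {k} p) ≟ cell (row {k} p′)

  cell-injective : ∀ {i j} → cell i ≡ cell j → toℕ (rank i) % b ≡ toℕ (rank j) % b → i ≡ j
  cell-injective {i} {j} cell≡ rem≡ = rank-injective (Fin.toℕ-injective (begin
    toℕ (rank i)                              ≡⟨ m≡m%n+[m/n]*n (toℕ (rank i)) b ⟩
    toℕ (rank i) % b + toℕ (rank i) / b * b   ≡⟨ cong₂ (λ x y → x + y * b) rem≡ cell≡ ⟩
    toℕ (rank j) % b + toℕ (rank j) / b * b   ≡⟨ m≡m%n+[m/n]*n (toℕ (rank j)) b ⟨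
    toℕ (rank j)                              ∎))
    where open ≡-Reasoning

  residue : Fin k → Fin b
  residue i = toℕ (rank i) mod b

  residue-% : ∀ i j → residue i ≡ residue j → toℕ (rank i) % b ≡ toℕ (rank j) % b
  residue-% i j = Fin.fromℕ<-injective _ _ (m%n<n (toℕ (rank i)) b) (m%n<n (toℕ (rank j)) b)

  block-size : ∀ p → count (sameBlock? p) ≤ b * b
  block-size p = count≤size (sameBlock? p)
    (λ p′ → combine (residue (column {k} p′)) (residue (row {k} p′)))
    λ {p₁} {p₂} (x₁ , y₁) (x₂ , y₂) eq →
      let eqˣ , eqʸ = Fin.combine-injective (residue (column {k} p₁)) (residue (row {k} p₁))
                                            (residue (column {k} p₂)) (residue (row {k} p₂)) eq in
      grid-ext {k} (cell-injective (trans (sym x₁) x₂) (residue-% (column {k} p₁) (column {k} p₂) eqˣ))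
                   (cell-injective (trans (sym y₁) y₂) (residue-% (row {k} p₁) (row {k} p₂) eqʸ))

  -- An accompanied point `p` has a neighbour `p′` in its own block, and the pair of distinct points
  -- determines the slope. So it suffices to count pairs within a common block.
  few-accompanied : ∑[ w < q ] count (accompanied? w) ≤ k * k * (b * b)
  few-accompanied = begin
    ∑[ w < q ] ∑[ p < k * k ] 𝟙 (accompanied? w p)
      ≤⟨ sum-mono (λ w → sum-mono λ p → 𝟙≤ (accompanied? w p) λ (p′ , n) → 1≤count (neighbour? w p) p′ n) ⟩
    ∑[ w < q ] ∑[ p < k * k ] ∑[ p′ < k * k ] 𝟙 (neighbour? w p p′)
      ≡⟨ ∑-comm (λ w p → ∑[ p′ < k * k ] 𝟙 (neighbour? w p p′)) ⟩
    ∑[ p < k * k ] ∑[ w < q ] ∑[ p′ < k * k ] 𝟙 (neighbour? w p p′)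
      ≡⟨ sum-cong-≗ (λ p → ∑-comm (λ w p′ → 𝟙 (neighbour? w p p′))) ⟩
    ∑[ p < k * k ] ∑[ p′ < k * k ] ∑[ w < q ] 𝟙 (neighbour? w p p′)
      ≤⟨ sum-mono (λ p → sum-mono λ p′ → one-slope p p′) ⟩
    ∑[ p < k * k ] ∑[ p′ < k * k ] 𝟙 (sameBlock? p p′)
      ≤⟨ sum≤ block-size ⟩
    k * k * (b * b) ∎
    where
    open ≤-Reasoning
    one-slope : ∀ p p′ → ∑[ w < q ] 𝟙 (neighbour? w p p′) ≤ 𝟙 (sameBlock? p p′)
    one-slope p p′ = subst (∑[ w < q ] 𝟙 (neighbour? w p p′) ≤_) (*-identityˡ _)
      (≤*𝟙 (sameBlock? p p′)
        (λ _ → count≤1 (λ w → neighbour? w p p′)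
                 λ (p≢p′ , c , _) (_ , c′ , _) → slope-unique p≢p′ c c′)
        (λ ¬same → ≤-trans (sum≤ λ w → 𝟙≤ (neighbour? w p p′)
                     λ (_ , c , eq) → contradiction (colour⇒block c eq) ¬same)
                   (≤-reflexive (*-zeroʳ q))))

  -- The constant is 2 times 9²: the 2 comes from `half-accompanied`, the 9 from `b*s≤9k`.
  few-rich : s * s * #rich s ≤ 162 * (k * k * (k * k))
  few-rich = begin
    s * s * #rich s
      ≤⟨ *-monoʳ-≤ (s * s) (sum-mono half-accompanied) ⟩
    s * s * ∑[ w < q ] (2 * count (accompanied? w))
      ≡⟨ cong (s * s *_) (*-distribˡ-sum 2 (λ w → count (accompanied? w))) ⟨
    s * s * (2 * ∑[ w < q ] count (accompanied? w))
      ≤⟨ *-monoʳ-≤ (s * s) (*-monoʳ-≤ 2 few-accompanied) ⟩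
    s * s * (2 * (k * k * (b * b)))
      ≡⟨ rearrange s k b ⟩
    2 * (k * k) * (b * s * (b * s))
      ≤⟨ *-monoʳ-≤ (2 * (k * k)) (*-mono-≤ b*s≤9k b*s≤9k) ⟩
    2 * (k * k) * (9 * k * (9 * k))
      ≡⟨ collect k ⟩
    162 * (k * k * (k * k)) ∎
    where
    open ≤-Reasoning
    rearrange : ∀ s k b → s * s * (2 * (k * k * (b * b))) ≡ 2 * (k * k) * (b * s * (b * s))
    rearrange = solve-∀
    collect : ∀ k → 2 * (k * k) * (9 * k * (9 * k)) ≡ 162 * (k * k * (k * k))
    collect = solve-∀

-- For s < 4 the trivial count of all points on all lines suffices.
#rich-bound : ∀ {q k} (L : Lines q k) {K} → 1 ≤ K → q ≤ K * (k * k) → ∀ s →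
              s * s * Lines.#rich L s ≤ 162 * K * (k * k * (k * k))
#rich-bound {q} {k} L {K} 1≤K q≤ s with 4 ≤? s | s ≤? k
... | yes 4≤s | yes s≤k = begin
  s * s * #rich s    ≤⟨ Blocks.few-rich L s 4≤s s≤k ⟩
  162 * (k * k * (k * k))        ≤⟨ *-monoˡ-≤ (k * k * (k * k)) (*-monoʳ-≤ 162 1≤K) ⟩
  162 * K * (k * k * (k * k))    ∎
  where open ≤-Reasoning; open Lines L
... | yes _ | no s≰k = begin
  s * s * #rich s    ≤⟨ *-monoʳ-≤ (s * s) (sum≤ λ w → sum≤ λ p → 𝟙≤ (rich? s w p)
                          λ rich → contradiction (≤-trans rich (richness≤k w p)) s≰k) ⟩
  s * s * (q * (k * k * 0))  ≡⟨ zero-product s q k ⟩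
  0                          ≤⟨ z≤n ⟩
  162 * K * (k * k * (k * k))    ∎
  where
  open ≤-Reasoning; open Lines L
  zero-product : ∀ s q k → s * s * (q * (k * k * 0)) ≡ 0
  zero-product = solve-∀
... | no s<4 | _ = begin
  s * s * #rich s
    ≤⟨ *-mono-≤ (*-mono-≤ s≤4 s≤4) (sum≤ λ w → sum≤ λ p → 𝟙≤ (rich? s w p) λ _ → ≤-refl) ⟩
  16 * (q * (k * k * 1))              ≤⟨ *-monoʳ-≤ 16 (*-monoˡ-≤ (k * k * 1) q≤) ⟩
  16 * (K * (k * k) * (k * k * 1))    ≡⟨ rearrange K k ⟩
  16 * (K * (k * k * (k * k)))                    ≤⟨ *-monoˡ-≤ (K * (k * k * (k * k))) {16} {162} (toWitness {a? = 16 ≤? 162} _) ⟩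
  162 * (K * (k * k * (k * k)))                   ≡⟨ *-assoc 162 K (k * k * (k * k)) ⟨
  162 * K * (k * k * (k * k))                     ∎
  where
  open ≤-Reasoning; open Lines L
  s≤4 : s ≤ 4
  s≤4 = <⇒≤ (≰⇒> s<4)
  rearrange : ∀ K k → 16 * (K * (k * k) * (k * k * 1)) ≡ 16 * (K * (k * k * (k * k)))
  rearrange = solve-∀

-- Energy of two families of lines

-- The weights 1/3 and 2/3: U³ = U · U² is estimated by the first inequality
-- once and by the next two twice, so that the richness a cancels.
combine-bounds : ∀ e .{{_ : NonZero e}} {m n U T E} J c a .{{_ : NonZero a}} t N →
  a * a * U ≤ c * (m * m * (m * m)) →
  t * U ≤ e * a * N →
  t * t * N ≤ c * (n * n * (n * n)) →
  T ≤ J * U →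
  E ≤ J * J * (J * (e * t * (e * t) * (m * m * T))) →
  E ^ 3 ≤ (e * e * e * (J * J * (J * J)) * c) ^ 3 * (m ^ 10 * n ^ 8)
combine-bounds e {m} {n} {U} {T} {E} J c a t N ineq₁ ineq₂ ineq₃ ineq₄ ineq₅ = begin
  E ^ 3
    ≤⟨ ^-monoˡ-≤ 3 (≤-trans ineq₅ (*-monoʳ-≤ (J * J) (*-monoʳ-≤ J
         (*-monoʳ-≤ (e * t * (e * t)) (*-monoʳ-≤ (m * m) ineq₄))))) ⟩
  (J * J * (J * (e * t * (e * t) * (m * m * (J * U))))) ^ 3
    ≡⟨ cube e J t m U ⟩
  e⁶ * J¹² * M₆ * V
    ≤⟨ *-monoʳ-≤ (e⁶ * J¹² * M₆) V≤ ⟩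
  e⁶ * J¹² * M₆ * (e * e * (c * c * c * M₄ * N₈))
    -- So far `e` occurs to the power 8; one more factor makes the power 9, a cube.
    ≤⟨ m≤n*m _ e ⟩
  e * (e⁶ * J¹² * M₆ * (e * e * (c * c * c * M₄ * N₈)))
    ≡⟨ collect e (J * J * (J * J)) c M₄ M₆ N₈ ⟩
  (e * e * e * (J * J * (J * J)) * c) ^ 3 * (M₄ * M₆ * N₈)
    ≡⟨ cong ((e * e * e * (J * J * (J * J)) * c) ^ 3 *_) (cong₂ _*_ (m¹⁰ m) (n⁸ n)) ⟩
  (e * e * e * (J * J * (J * J)) * c) ^ 3 * (m ^ 10 * n ^ 8) ∎
  where
  open ≤-Reasoning
  e⁶ = e * e * (e * e) * (e * e)
  J¹² = J * J * (J * J) * (J * J * (J * J)) * (J * J * (J * J))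
  M₄ = m * m * (m * m)
  M₆ = m * m * (m * m) * (m * m)
  N₈ = n * n * (n * n) * (n * n * (n * n))
  V = t * t * (t * t) * (t * t) * (U * U * U)
  t³U≤ : t * t * (t * U) ≤ e * a * (c * (n * n * (n * n)))
  t³U≤ = begin
    t * t * (t * U)                      ≤⟨ *-monoʳ-≤ (t * t) ineq₂ ⟩
    t * t * (e * a * N)                  ≡⟨ swap e t a N ⟩
    e * a * (t * t * N)                  ≤⟨ *-monoʳ-≤ (e * a) ineq₃ ⟩
    e * a * (c * (n * n * (n * n)))      ∎
    where
    swap : ∀ e t a N → t * t * (e * a * N) ≡ e * a * (t * t * N)
    swap = solve-∀
  V≤ : V ≤ e * e * (c * c * c * M₄ * N₈)
  V≤ = *-cancelˡ-≤ a (*-cancelˡ-≤ a (begin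
    a * (a * V)
      ≡⟨ split a t U ⟩
    a * a * U * (t * t * (t * U) * (t * t * (t * U)))
      ≤⟨ *-mono-≤ ineq₁ (*-mono-≤ t³U≤ t³U≤) ⟩
    c * M₄ * (e * a * (c * (n * n * (n * n))) * (e * a * (c * (n * n * (n * n)))))
      ≡⟨ join e a c M₄ (n * n * (n * n)) ⟩
    a * (a * (e * e * (c * c * c * M₄ * N₈))) ∎))
    where
    split : ∀ a t U → a * (a * (t * t * (t * t) * (t * t) * (U * U * U))) ≡
                      a * a * U * (t * t * (t * U) * (t * t * (t * U)))
    split = solve-∀
    join : ∀ e a c M N → c * M * (e * a * (c * N) * (e * a * (c * N))) ≡
                         a * (a * (e * e * (c * c * c * M * (N * N))))
    join = solve-∀
  cube : ∀ e J t m U →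
    (J * J * (J * (e * t * (e * t) * (m * m * (J * U))))) *
    ((J * J * (J * (e * t * (e * t) * (m * m * (J * U))))) *
    ((J * J * (J * (e * t * (e * t) * (m * m * (J * U))))) * 1)) ≡
    e * e * (e * e) * (e * e) *
      (J * J * (J * J) * (J * J * (J * J)) * (J * J * (J * J))) *
      (m * m * (m * m) * (m * m)) * (t * t * (t * t) * (t * t) * (U * U * U))
  cube = solve-∀
  collect : ∀ e J c M M′ N →
    e * (e * e * (e * e) * (e * e) * (J * J * J) * M′ * (e * e * (c * c * c * M * N))) ≡
    (e * e * e * J * c) * ((e * e * e * J * c) * ((e * e * e * J * c) * 1)) * (M * M′ * N)
  collect = solve-∀
  m¹⁰ : ∀ m → m * m * (m * m) * (m * m * (m * m) * (m * m)) ≡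
              m * (m * (m * (m * (m * (m * (m * (m * (m * (m * 1)))))))))
  m¹⁰ = solve-∀
  n⁸ : ∀ n → n * n * (n * n) * (n * n * (n * n)) ≡
             n * (n * (n * (n * (n * (n * (n * (n * 1)))))))
  n⁸ = solve-∀

-- Match w p x says that the line of slope w through p, in the first grid,
-- corresponds to the one through x in the second grid.
module Energy {q m n} (L₁ : Lines q m) (L₂ : Lines q n)
  (Match : Fin q → Fin (m * m) → Fin (n * n) → Set)
  (match? : ∀ w p x → Dec (Match w p x))
  (match⇒collinear₁ : ∀ {w p p′ x} → Match w p x → Match w p′ x → Lines.Collinear L₁ w p p′)
  (match⇒collinear₂ : ∀ {w p x x′} → Match w p x → Match w p x′ → Lines.Collinear L₂ w x x′)
  where

  private
    module L₁ = Lines L₁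
    module L₂ = Lines L₂

  degree : Fin q → Fin (m * m) → ℕ
  degree w p = count (match? w p)

  #matches : Fin q → ℕ
  #matches w = ∑[ p < m * m ] degree w p

  energy : ℕ
  energy = ∑[ w < q ] (#matches w * #matches w)

  -- All points matched with `p` lie on one line of the second grid, the one through `x`.
  degree≤richness : ∀ {w p x} → Match w p x → degree w p ≤ L₂.richness w x
  degree≤richness {w} {p} {x} M =
    sum-mono λ x′ → 𝟙-mono (match? w p x′) (L₂.collinear? w x x′) (match⇒collinear₂ M)

  degree≤n : ∀ w p → degree w p ≤ n
  degree≤n w p with Fin.any? (match? w p)
  ... | yes (x , M) = ≤-trans (degree≤richness M) (L₂.richness≤k w x)
  ... | no ¬M = ≤-trans (sum≤ {c = 0} λ x → 𝟙≤ (match? w p x) λ M → contradiction (x , M) ¬M)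
                        (≤-trans (≤-reflexive (*-zeroʳ (n * n))) z≤n)

  -- The energy counts pairs of matches `(p , x)`, `(p′ , x′)` with a common slope. The given family
  -- is embedded into the flattened index set of such pairs, and the four points alone tell its
  -- members apart.
  quadruples≤energy : ∀ {r} (w : Fin r → Fin q) (p p′ : Fin r → Fin (m * m)) (x x′ : Fin r → Fin (n * n)) →
    (∀ {i j} → p i ≡ p j → x i ≡ x j → p′ i ≡ p′ j → x′ i ≡ x′ j → i ≡ j) →
    (∀ i → Match (w i) (p i) (x i)) → (∀ i → Match (w i) (p′ i) (x′ i)) → r ≤ energy
  quadruples≤energy {r} w p p′ x x′ inj M M′ = begin
    r                                          ≡⟨ trans (sum-const r 1) (*-identityʳ r) ⟨
    count {r} (λ _ → yes tt)                   ≤⟨ count≤sum (λ _ → yes tt) index weight index-injective hit ⟩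
    sum weight                                 ≡⟨ sum-remQuot q (λ (w , v) → weight₂ w (remQuot {Y} Y v)) ⟩
    ∑[ w < q ] sum (weight₂ w ∘ remQuot {Y} Y) ≡⟨ sum-cong-≗ square ⟩
    energy                                     ∎
    where
    open ≤-Reasoning
    Y = (m * m) * (n * n)
    matched : Fin q → Fin (m * m) × Fin (n * n) → ℕ
    matched w (p , x) = 𝟙 (match? w p x)
    weight₁ : Fin q → Fin Y → ℕ
    weight₁ w y = matched w (remQuot {m * m} (n * n) y)
    weight₂ : Fin q → Fin Y × Fin Y → ℕ
    weight₂ w (y , y′) = weight₁ w y * weight₁ w y′
    weight : Fin (q * (Y * Y)) → ℕ
    weight u = (λ (w , v) → weight₂ w (remQuot {Y} Y v)) (remQuot {q} (Y * Y) u)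
    index : Fin r → Fin (q * (Y * Y))
    index i = combine (w i) (combine (combine (p i) (x i)) (combine (p′ i) (x′ i)))
    index-injective : ∀ {i j} → ⊤ → ⊤ → index i ≡ index j → i ≡ j
    index-injective {i} {j} _ _ eq =
      let yy′≡ = Fin.combine-injectiveʳ (w i) _ (w j) _ eq
          y≡ , y′≡ = Fin.combine-injective (combine (p i) (x i)) _ (combine (p j) (x j)) _ yy′≡
          p≡ , x≡ = Fin.combine-injective (p i) _ (p j) _ y≡
          p′≡ , x′≡ = Fin.combine-injective (p′ i) _ (p′ j) _ y′≡
      in inj p≡ x≡ p′≡ x′≡
    weight-index : ∀ i → weight (index i) ≡ 𝟙 (match? (w i) (p i) (x i)) * 𝟙 (match? (w i) (p′ i) (x′ i))
    weight-index i = trans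
      (cong (λ (w , v) → weight₂ w (remQuot {Y} Y v)) (Fin.remQuot-combine (w i) _))
      (trans (cong (weight₂ (w i)) (Fin.remQuot-combine (combine (p i) (x i)) (combine (p′ i) (x′ i))))
        (cong₂ (λ y y′ → matched (w i) y * matched (w i) y′)
          (Fin.remQuot-combine (p i) (x i)) (Fin.remQuot-combine (p′ i) (x′ i))))
    hit : ∀ {i} → ⊤ → 1 ≤ weight (index i)
    hit {i} _ = ≤-trans (*-mono-≤ (1≤𝟙 (match? (w i) (p i) (x i)) (M i))
                                  (1≤𝟙 (match? (w i) (p′ i) (x′ i)) (M′ i)))
                        (≤-reflexive (sym (weight-index i)))
    sum-weight₁ : ∀ w → sum (weight₁ w) ≡ #matches w
    sum-weight₁ w = sum-remQuot (m * m) (matched w)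
    square : ∀ w → sum (weight₂ w ∘ remQuot {Y} Y) ≡ #matches w * #matches w
    square w = begin-equality
      sum (weight₂ w ∘ remQuot {Y} Y)
        ≡⟨ sum-remQuot Y (weight₂ w) ⟩
      ∑[ y < Y ] ∑[ y′ < Y ] (weight₁ w y * weight₁ w y′)
        ≡⟨ sum-cong-≗ (λ y → *-distribˡ-sum (weight₁ w y) (weight₁ w)) ⟨
      ∑[ y < Y ] (weight₁ w y * sum (weight₁ w))
        ≡⟨ *-distribʳ-sum (sum (weight₁ w)) (weight₁ w) ⟨
      sum (weight₁ w) * sum (weight₁ w)
        ≡⟨ cong₂ _*_ (sum-weight₁ w) (sum-weight₁ w) ⟩
      #matches w * #matches w ∎

  -- Dyadic classes of degree and richness

  degree? : ∀ j w p → Dec (Dyadic j (degree w p))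
  degree? j w p = dyadic? j (degree w p)

  #degree : ℕ → Fin q → ℕ
  #degree j w = count (degree? j w)

  both? : ∀ i j w p → Dec (Dyadic i (L₁.richness w p) × Dyadic j (degree w p))
  both? i j w p = dyadic? i (L₁.richness w p) ×-dec degree? j w p

  #both : ℕ → ℕ → ℕ
  #both i j = ∑[ w < q ] count (both? i j w)

  #both≤#rich₁ : ∀ i j → #both i j ≤ L₁.#rich (2 ^ i)
  #both≤#rich₁ i j = sum-mono λ w → sum-mono λ p →
    𝟙-mono (both? i j w p) (L₁.rich? (2 ^ i) w p) (proj₁ ∘ proj₁)

  -- Double counting of the matches of the points `p` in the class. Each `p` has at least `2 ^ j`
  -- partners, all on a line of at least that richness. Conversely, the points matched with one `x`
  -- lie on one line of the first grid, of richness below `2 ^ suc i`.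
  #both≤#rich₂ : ∀ i j → 2 ^ j * #both i j ≤ 2 ^ suc i * L₂.#rich (2 ^ j)
  #both≤#rich₂ i j = begin
    2 ^ j * #both i j
      ≡⟨ *-distribˡ-sum (2 ^ j) (λ w → count (both? i j w)) ⟩
    ∑[ w < q ] (2 ^ j * count (both? i j w))
      ≤⟨ sum-mono per-slope ⟩
    ∑[ w < q ] (2 ^ suc i * count (L₂.rich? (2 ^ j) w))
      ≡⟨ *-distribˡ-sum (2 ^ suc i) (λ w → count (L₂.rich? (2 ^ j) w)) ⟨
    2 ^ suc i * L₂.#rich (2 ^ j) ∎
    where
    open ≤-Reasoning
    from? : ∀ w x p → Dec ((Dyadic i (L₁.richness w p) × Dyadic j (degree w p)) × Match w p x)
    from? w x p = both? i j w p ×-dec match? w p x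
    on-line : ∀ w x → count (from? w x) ≤ 2 ^ suc i * 𝟙 (L₂.rich? (2 ^ j) w x)
    on-line w x with Fin.any? (from? w x)
    ... | no none = ≤-trans
            (sum≤ {c = 0} λ p → 𝟙≤ (from? w x p) λ b → contradiction (p , b) none)
            (≤-trans (≤-reflexive (*-zeroʳ (m * m))) z≤n)
    ... | yes (p₀ , ((_ , ρ<) , (≤δ , _)) , M₀) = ≤*𝟙 (L₂.rich? (2 ^ j) w x)
            (λ _ → ≤-trans (sum-mono λ p → 𝟙-mono (from? w x p) (L₁.collinear? w p₀ p)
                                             λ (_ , M) → match⇒collinear₁ M₀ M)
                           (<⇒≤ ρ<))
            (λ ¬rich → contradiction (≤-trans ≤δ (degree≤richness M₀)) ¬rich)
    at-point : ∀ w p → 2 ^ j * 𝟙 (both? i j w p) ≤ ∑[ x < n * n ] 𝟙 (from? w x p)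
    at-point w p = ≤-trans (≤-reflexive (*-comm (2 ^ j) _)) (𝟙*≤ (both? i j w p) λ b →
      ≤-trans (proj₁ (proj₂ b)) (sum-mono λ x → 𝟙-mono (match? w p x) (from? w x p) (b ,_)))
    per-slope : ∀ w → 2 ^ j * count (both? i j w) ≤ 2 ^ suc i * count (L₂.rich? (2 ^ j) w)
    per-slope w = begin
      2 ^ j * count (both? i j w)
        ≡⟨ *-distribˡ-sum (2 ^ j) (λ p → 𝟙 (both? i j w p)) ⟩
      ∑[ p < m * m ] (2 ^ j * 𝟙 (both? i j w p))
        ≤⟨ sum-mono (at-point w) ⟩
      ∑[ p < m * m ] ∑[ x < n * n ] 𝟙 (from? w x p)
        ≡⟨ ∑-comm (λ p x → 𝟙 (from? w x p)) ⟩
      ∑[ x < n * n ] ∑[ p < m * m ] 𝟙 (from? w x p)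
        ≤⟨ sum-mono (on-line w) ⟩
      ∑[ x < n * n ] (2 ^ suc i * 𝟙 (L₂.rich? (2 ^ j) w x))
        ≡⟨ *-distribˡ-sum (2 ^ suc i) (λ x → 𝟙 (L₂.rich? (2 ^ j) w x)) ⟨
      2 ^ suc i * count (L₂.rich? (2 ^ j) w) ∎

  module _ (J : ℕ) .{{_ : NonZero J}} (m<2^J : m < 2 ^ J) (n<2^J : n < 2 ^ J) where

    matches-dyadic : ∀ w → #matches w ≤ ∑[ j < J ] (2 ^ suc (toℕ j) * #degree (toℕ j) w)
    matches-dyadic w = begin
      ∑[ p < m * m ] degree w p
        ≤⟨ sum-mono at-point ⟩
      ∑[ p < m * m ] ∑[ j < J ] (2 ^ suc (toℕ j) * 𝟙 (degree? (toℕ j) w p))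
        ≡⟨ ∑-comm (λ p (j : Fin J) → 2 ^ suc (toℕ j) * 𝟙 (degree? (toℕ j) w p)) ⟩
      ∑[ j < J ] ∑[ p < m * m ] (2 ^ suc (toℕ j) * 𝟙 (degree? (toℕ j) w p))
        ≡⟨ sum-cong-≗ {J} (λ j → *-distribˡ-sum (2 ^ suc (toℕ j)) (λ p → 𝟙 (degree? (toℕ j) w p))) ⟨
      ∑[ j < J ] (2 ^ suc (toℕ j) * #degree (toℕ j) w) ∎
      where
      open ≤-Reasoning
      at-point : ∀ p → degree w p ≤ ∑[ j < J ] (2 ^ suc (toℕ j) * 𝟙 (degree? (toℕ j) w p))
      at-point p with degree w p ≤? 0
      ... | yes δ≤0 = ≤-trans δ≤0 z≤n
      ... | no  δ≰0 with dyadic-class J (degree w p) (≰⇒> δ≰0) (≤-<-trans (degree≤n w p) n<2^J)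
      ... | j , d = ≤-trans
        (≤*𝟙 (degree? (toℕ j) w p) (λ (_ , δ<) → <⇒≤ δ<) (λ ¬d → contradiction d ¬d))
        (term≤sum {J} (λ j → 2 ^ suc (toℕ j) * 𝟙 (degree? (toℕ j) w p)) j)

    -- The pigeonhole principle is applied twice. First the best class is chosen for each slope,
    -- which costs `J * J` after squaring; then one class for all slopes together, which costs
    -- another `J`.
    energy-dyadic : ∃ λ j → energy ≤
      J * J * (J * (2 ^ suc j * 2 ^ suc j * (m * m * ∑[ w < q ] #degree j w)))
    energy-dyadic = toℕ j* , (begin
      ∑[ w < q ] (#matches w * #matches w)
        ≤⟨ sum-mono at-slope ⟩
      ∑[ w < q ] (J * J * ∑[ j < J ] (a j * a j * (m * m * d j w)))
        ≡⟨ *-distribˡ-sum (J * J) (λ w → ∑[ j < J ] (a j * a j * (m * m * d j w))) ⟨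
      J * J * ∑[ w < q ] ∑[ j < J ] (a j * a j * (m * m * d j w))
        ≡⟨ cong (J * J *_) (∑-comm (λ w j → a j * a j * (m * m * d j w))) ⟩
      J * J * ∑[ j < J ] ∑[ w < q ] (a j * a j * (m * m * d j w))
        ≡⟨ cong (J * J *_) (sum-cong-≗ factor) ⟩
      J * J * ∑[ j < J ] total j
        ≤⟨ *-monoʳ-≤ (J * J) (proj₂ (sum≤max total)) ⟩
      J * J * (J * total j*) ∎)
      where
      open ≤-Reasoning
      a : Fin J → ℕ
      a j = 2 ^ suc (toℕ j)
      d : Fin J → Fin q → ℕ
      d j w = #degree (toℕ j) w
      total : Fin J → ℕ
      total j = a j * a j * (m * m * ∑[ w < q ] d j w)
      j* : Fin J
      j* = proj₁ (sum≤max total)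
      factor : ∀ j → ∑[ w < q ] (a j * a j * (m * m * d j w)) ≡ total j
      factor j = sym (trans (cong (a j * a j *_) (*-distribˡ-sum (m * m) (d j)))
                            (*-distribˡ-sum (a j * a j) (λ w → m * m * d j w)))
      square : ∀ J a d → J * (a * d) * (J * (a * d)) ≡ J * J * (a * a * (d * d))
      square = solve-∀
      d≤m*m : ∀ j w → d j w ≤ m * m
      d≤m*m j w = ≤-trans (sum≤ {c = 1} λ p → 𝟙≤ (degree? (toℕ j) w p) λ _ → ≤-refl)
                          (≤-reflexive (*-identityʳ (m * m)))
      at-slope : ∀ w → #matches w * #matches w ≤ J * J * ∑[ j < J ] (a j * a j * (m * m * d j w))
      at-slope w with sum≤max (λ j → a j * d j w)
      ... | j , h = begin
        #matches w * #matches w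
          ≤⟨ *-mono-≤ (≤-trans (matches-dyadic w) h) (≤-trans (matches-dyadic w) h) ⟩
        J * (a j * d j w) * (J * (a j * d j w))
          ≡⟨ square J (a j) (d j w) ⟩
        J * J * (a j * a j * (d j w * d j w))
          -- One of the two factors `d j w` is bounded by the number of points of the grid; the
          -- other is kept for the sum over all slopes.
          ≤⟨ *-monoʳ-≤ (J * J) (*-monoʳ-≤ (a j * a j) (*-monoˡ-≤ (d j w) (d≤m*m j w))) ⟩
        J * J * (a j * a j * (m * m * d j w))
          ≤⟨ *-monoʳ-≤ (J * J) (term≤sum (λ j → a j * a j * (m * m * d j w)) j) ⟩
        J * J * ∑[ j < J ] (a j * a j * (m * m * d j w)) ∎

    -- The richness of a point in the first grid is between 1 and `m`, so it falls into one of the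
    -- `J` classes; the most frequent class is kept.
    degree-dyadic : ∀ j → ∃ λ i → ∑[ w < q ] #degree j w ≤ J * #both i j
    degree-dyadic j = toℕ i* , (begin
      ∑[ w < q ] ∑[ p < m * m ] 𝟙 (degree? j w p)
        ≤⟨ sum-mono (λ w → sum-mono λ p → 𝟙≤ (degree? j w p) (classify w p)) ⟩
      ∑[ w < q ] ∑[ p < m * m ] ∑[ i < J ] 𝟙 (both? (toℕ i) j w p)
        ≡⟨ sum-cong-≗ (λ w → ∑-comm (λ p (i : Fin J) → 𝟙 (both? (toℕ i) j w p))) ⟩
      ∑[ w < q ] ∑[ i < J ] count (both? (toℕ i) j w)
        ≡⟨ ∑-comm (λ w (i : Fin J) → count (both? (toℕ i) j w)) ⟩
      ∑[ i < J ] #both (toℕ i) j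
        ≤⟨ proj₂ (sum≤max {J} (λ i → #both (toℕ i) j)) ⟩
      J * #both (toℕ i*) j ∎)
      where
      open ≤-Reasoning
      i* : Fin J
      i* = proj₁ (sum≤max {J} (λ i → #both (toℕ i) j))
      classify : ∀ w p → Dyadic j (degree w p) → 1 ≤ ∑[ i < J ] 𝟙 (both? (toℕ i) j w p)
      classify w p d with dyadic-class J (L₁.richness w p) (L₁.1≤richness w p)
                                       (≤-<-trans (L₁.richness≤k w p) m<2^J)
      ... | i , e = 1≤count {J} (λ i → both? (toℕ i) j w p) i (e , d)

    energy-bound : ∀ {K} → 1 ≤ K → q ≤ K * (m * m) → m ≤ n →
      energy ^ 3 ≤ (2 * 2 * 2 * (J * J * (J * J)) * (162 * K)) ^ 3 * (m ^ 10 * n ^ 8)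
    energy-bound {K} 1≤K q≤ m≤n =
      let j , E≤ = energy-dyadic
          i , T≤ = degree-dyadic j
      in combine-bounds 2 {m} {n} J (162 * K) (2 ^ i) {{m^n≢0 2 i}} (2 ^ j) (L₂.#rich (2 ^ j))
        (≤-trans (*-monoʳ-≤ (2 ^ i * 2 ^ i) (#both≤#rich₁ i j)) (#rich-bound L₁ 1≤K q≤ (2 ^ i)))
        (#both≤#rich₂ i j)
        -- The bound on the number of slopes carries over to the second grid because `m ≤ n`.
        (#rich-bound L₂ 1≤K (≤-trans q≤ (*-monoʳ-≤ K (*-mono-≤ m≤n m≤n))) (2 ^ j))
        T≤ E≤

-- The lines spanned by finite sets of reals

module Ranking {k} (_⊰_ : Fin k → Fin k → Set) (_⊰?_ : ∀ i j → Dec (i ⊰ j))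
  (⊰-trans : ∀ {h i j} → h ⊰ i → i ⊰ j → h ⊰ j) (⊰-irrefl : ∀ {i} → ¬ i ⊰ i)
  (⊰-connex : ∀ {i j} → ¬ i ⊰ j → ¬ j ⊰ i → i ≡ j) where

  -- Replaces real coordinates by positions in the order, which integer division can group into
  -- blocks.
  #below : Fin k → ℕ
  #below i = count (_⊰? i)

  #below< : ∀ i → #below i < k
  #below< i = subst (#below i <_) (trans (sum-const k 1) (*-identityʳ k))
    (sum-mono-< (λ j → 𝟙≤ (j ⊰? i) λ _ → ≤-refl) i
      (s≤s (𝟙≤ (i ⊰? i) λ i⊰i → contradiction i⊰i ⊰-irrefl)))

  rank : Fin k → Fin k
  rank i = fromℕ< (#below< i)

  rank-mono : ∀ {i j} → i ⊰ j → toℕ (rank i) < toℕ (rank j)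
  rank-mono {i} {j} i⊰j = subst₂ _<_ (sym (Fin.toℕ-fromℕ< (#below< i))) (sym (Fin.toℕ-fromℕ< (#below< j)))
    (sum-mono-< (λ h → 𝟙-mono (h ⊰? i) (h ⊰? j) λ h⊰i → ⊰-trans h⊰i i⊰j) i
      (≤-trans (s≤s (𝟙≤ (i ⊰? i) λ i⊰i → contradiction i⊰i ⊰-irrefl)) (1≤𝟙 (i ⊰? j) i⊰j)))

  rank-reflects-≤ : ∀ {i j} → toℕ (rank i) ≤ toℕ (rank j) → i ≡ j ⊎ i ⊰ j
  rank-reflects-≤ {i} {j} le with i ⊰? j | j ⊰? i
  ... | yes i⊰j | _       = inj₂ i⊰j
  ... | no  _   | yes j⊰i = contradiction (rank-mono j⊰i) (≤⇒≯ le)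
  ... | no ¬i⊰j | no ¬j⊰i = inj₁ (⊰-connex ¬i⊰j ¬j⊰i)

  rank-reflects-< : ∀ {i j} → toℕ (rank i) < toℕ (rank j) → i ⊰ j
  rank-reflects-< lt with rank-reflects-≤ (<⇒≤ lt)
  ... | inj₁ refl = contradiction lt (<-irrefl refl)
  ... | inj₂ i⊰j  = i⊰j

  rank-injective : ∀ {i j} → rank i ≡ rank j → i ≡ j
  rank-injective {i} {j} eq with rank-reflects-≤ {i} {j} (≤-reflexive (cong toℕ eq))
  ... | inj₁ i≡j = i≡j
  ... | inj₂ i⊰j = contradiction (rank-mono i⊰j) (<-irrefl (cong toℕ eq))

OnLine : (Z A : FiniteSubset) → Fin (card Z) → (p p′ : Fin (card A * card A)) → Set
OnLine Z A w p p′ = SameLine (elem Z w) (elem A (column {card A} p)) (elem A (row {card A} p))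
                                        (elem A (column {card A} p′)) (elem A (row {card A} p′))

-- Only finitely many instances are asked for, so such decisions exist up to double negation
-- although order and equality of reals are undecidable.
record DecidableRelations (Z A : FiniteSubset) : Set where
  field
    less?   : ∀ i j → Dec (elem A i ⊏ elem A j)
    onLine? : ∀ w p p′ → Dec (OnLine Z A w p p′)
    pos?    : ∀ w → Dec (Pos (seq (elem Z w)))
    neg?    : ∀ w → Dec (Neg (seq (elem Z w)))

lines : (Z A : FiniteSubset) → DecidableRelations Z A → Lines (card Z) (card A)
lines Z A dec = record
  { Collinear = OnLine Z A
  ; collinear? = onLine?
  ; c-refl = λ {w} {p} → sameLine-refl (z w) (x p) (y p)
  ; c-sym = λ {w} {p} {p′} → sameLine-sym (z w) (x p) (y p) (x p′) (y p′)
  ; c-trans = λ {w} {p} {p′} {p″} → sameLine-trans (z w) (x p) (y p) (x p′) (y p′) (x p″) (y p″)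
  ; row-unique = λ {w} {p} {p′} → row-unique {w} {p} {p′}
  ; slope-unique = λ {w} {w′} {p} {p′} → slope-unique {w} {w′} {p} {p′}
  ; rank = rank
  ; rank-injective = rank-injective
  ; monotone = monotone
  }
  where
  open DecidableRelations dec
  k = card A
  a = elem A
  z = elem Z
  x y : Fin (k * k) → ℝ
  x p = a (column {k} p)
  y p = a (row {k} p)
  open Ranking (λ i j → a i ⊏ a j) less?
    (λ {h} {i} {j} → ⊏-trans (a h) (a i) (a j)) (λ {i} → ⊏-irrefl (a i))
    (λ {i} {j} ¬lt ¬gt → injective A (¬⊏∧¬⊐⇒≃ (a i) (a j) ¬gt ¬lt))
  same-row : ∀ {w p p′} → OnLine Z A w p p′ → row {k} p ≡ row {k} p′ → x p ≃ x p′
  same-row {w} {p} {p′} l eq = sameLine-row (z w) (x p) (y p) (x p′)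
    (subst (λ i → SameLine (z w) (x p) (y p) (x p′) (a i)) (sym eq) l)
  row-unique : ∀ {w p p′} → OnLine Z A w p p′ → row {k} p ≡ row {k} p′ → p ≡ p′
  row-unique {w} {p} {p′} l eq = grid-ext {k} (injective A (same-row {w} {p} {p′} l eq)) eq
  slope-unique : ∀ {w w′ p p′} → p ≢ p′ → OnLine Z A w p p′ → OnLine Z A w′ p p′ → w ≡ w′
  slope-unique {w} {w′} {p} {p′} p≢p′ l l′ with less? (row {k} p) (row {k} p′) | less? (row {k} p′) (row {k} p)
  ... | yes lt | _ = injective Z
          (sameLine-slope (z w) (z w′) (x p) (y p) (x p′) (y p′) lt l l′)
  ... | no _ | yes gt = injective Z
          (sameLine-slope (z w) (z w′) (x p′) (y p′) (x p) (y p) gt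
            (sameLine-sym (z w) (x p) (y p) (x p′) (y p′) l)
            (sameLine-sym (z w′) (x p) (y p) (x p′) (y p′) l′))
  -- Distinct points of a line lie in different rows, so one of the strict comparisons must hold.
  ... | no ¬lt | no ¬gt = contradiction
          (row-unique {w} {p} {p′} l (injective A (¬⊏∧¬⊐⇒≃ (y p) (y p′) ¬gt ¬lt))) p≢p′
  rankˣ rankʸ : Fin (k * k) → ℕ
  rankˣ p = toℕ (rank (column {k} p))
  rankʸ p = toℕ (rank (row {k} p))
  monotone : ∀ w → (∀ {p p′} → OnLine Z A w p p′ → rankʸ p ≤ rankʸ p′ → rankˣ p ≤ rankˣ p′) ⊎
                   (∀ {p p′} → OnLine Z A w p p′ → rankʸ p ≤ rankʸ p′ → rankˣ p′ ≤ rankˣ p)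
  monotone w with pos? w | neg? w
  ... | yes 0⊏z | _ = inj₁ increasing
    where
    increasing : ∀ {p p′} → OnLine Z A w p p′ → rankʸ p ≤ rankʸ p′ → rankˣ p ≤ rankˣ p′
    increasing {p} {p′} l le = ≮⇒≥ λ gt → contradiction (rank-reflects-≤ le)
      λ { (inj₁ eq) → ≃⇒¬⊏ (x p) (x p′) (same-row {w} {p} {p′} l eq) (rank-reflects-< gt)
        ; (inj₂ lt) → sameLine-pos (z w) (x p) (y p) (x p′) (y p′) 0⊏z l (rank-reflects-< gt) lt }
  ... | no _ | yes z⊏0 = inj₂ decreasing
    where
    decreasing : ∀ {p p′} → OnLine Z A w p p′ → rankʸ p ≤ rankʸ p′ → rankˣ p′ ≤ rankˣ p
    decreasing {p} {p′} l le = ≮⇒≥ λ lt → contradiction (rank-reflects-≤ le)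
      λ { (inj₁ eq) → ≃⇒¬⊏ (x p′) (x p) (≃-sym (x p) (x p′) (same-row {w} {p} {p′} l eq)) (rank-reflects-< lt)
        ; (inj₂ y⊏) → sameLine-neg (z w) (x p′) (y p′) (x p) (y p) z⊏0
            (sameLine-sym (z w) (x p) (y p) (x p′) (y p′) l) (rank-reflects-< lt) y⊏ }
  -- The slope is zero, so the column is constant along the line and either alternative would hold.
  ... | no ¬pos | no ¬neg = inj₁ λ {p} {p′} l _ → ≮⇒≥ λ gt →
      ≃⇒¬⊏ (x p) (x p′)
        (sameLine-zero (z w) (x p) (y p) (x p′) (y p′) (¬pos∧¬neg⇒null (seq (z w)) (cauchy (z w)) ¬pos ¬neg) l)
        (rank-reflects-< gt)

Opposite : (Z A₁ A₂ : FiniteSubset) → Fin (card Z) →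
           Fin (card A₁) × Fin (card A₁) → Fin (card A₂) × Fin (card A₂) → Set
Opposite Z A₁ A₂ w (a , a′) (b , b′) =
  OppositeLines (elem Z w) (elem A₁ a) (elem A₁ a′) (elem A₂ b) (elem A₂ b′)

Match : (Z A₁ A₂ : FiniteSubset) → Fin (card Z) →
        Fin (card A₁ * card A₁) → Fin (card A₂ * card A₂) → Set
Match Z A₁ A₂ w p x = Opposite Z A₁ A₂ w (remQuot {card A₁} (card A₁) p) (remQuot {card A₂} (card A₂) x)

-- Finitely many decisions under double negation

open RawMonad (¬¬-Monad {0ℓ}) using (_>>=_; return; rawApplicative)

-- Double negation commutes with finite products, so excluded middle holds for all indices at once
-- under a single double negation.
¬¬-decidable : ∀ {n} (P : Fin n → Set) → ¬ ¬ (∀ i → Dec (P i))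
¬¬-decidable P = Fin.sequence rawApplicative λ i → ¬¬-excluded-middle

¬¬-decidable₂ : ∀ {m n} (P : Fin m → Fin n → Set) → ¬ ¬ (∀ i j → Dec (P i j))
¬¬-decidable₂ P = Fin.sequence rawApplicative λ i → ¬¬-decidable (P i)

¬¬-decidable₃ : ∀ {l m n} (P : Fin l → Fin m → Fin n → Set) → ¬ ¬ (∀ h i j → Dec (P h i j))
¬¬-decidable₃ P = Fin.sequence rawApplicative λ h → ¬¬-decidable₂ (P h)

¬¬-decidableRelations : ∀ Z A → ¬ ¬ DecidableRelations Z A
¬¬-decidableRelations Z A = do
  less?   ← ¬¬-decidable₂ λ i j → elem A i ⊏ elem A j
  onLine? ← ¬¬-decidable₃ (OnLine Z A)
  pos?    ← ¬¬-decidable λ w → Pos (seq (elem Z w))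
  neg?    ← ¬¬-decidable λ w → Neg (seq (elem Z w))
  return record { less? = less? ; onLine? = onLine? ; pos? = pos? ; neg? = neg? }

-- From solutions to the energy

module _ (Z A₁ A₂ : FiniteSubset) where
  private
    m = card A₁
    n = card A₂

  module _ (dec₁ : DecidableRelations Z A₁) (dec₂ : DecidableRelations Z A₂)
           (match? : ∀ w p x → Dec (Match Z A₁ A₂ w p x)) where

    private
      x₁ y₁ : Fin (m * m) → ℝ
      x₁ p = elem A₁ (column {m} p)
      y₁ p = elem A₁ (row {m} p)
      x₂ y₂ : Fin (n * n) → ℝ
      x₂ p = elem A₂ (column {n} p)
      y₂ p = elem A₂ (row {n} p)

    open Energy (lines Z A₁ dec₁) (lines Z A₂ dec₂) (Match Z A₁ A₂) match?
      (λ {w} {p} {p′} {x} → opposite⇒sameLine₁ (elem Z w) (x₁ p) (y₁ p) (x₁ p′) (y₁ p′) (x₂ x) (y₂ x))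
      (λ {w} {p} {x} {x′} → opposite⇒sameLine₂ (elem Z w) (x₁ p) (y₁ p) (x₂ x) (y₂ x) (x₂ x′) (y₂ x′))
      public using (energy; quadruples≤energy; energy-bound)

    -- With z the common value of the quotients, `(a₁ , a₁′)` matches `(a₂ , a₂′)` and `(a₁″ , a₁‴)`
    -- matches `(a₂″ , a₂‴)`. The two matches contain all eight entries, so distinct solutions give
    -- distinct pairs of matches.
    R≤energy : ∀ r → R≥ Z A₁ A₂ r → r ≤ energy
    R≤energy r (t , t-injective , solution) = quadruples≤energy
      (λ i → slope (solution i)) (p ∘ t) (p″ ∘ t) (x ∘ t) (x″ ∘ t)
      (λ {i} {j} eq₁ eq₂ eq₃ eq₄ → t-injective (octuple-ext (t i) (t j) eq₁ eq₂ eq₃ eq₄))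
      (λ i → match (t i) (solution i)) (λ i → match″ (t i) (solution i))
      where
      p p″ : Octuple A₁ A₂ → Fin (m * m)
      p  (a₁ , _ , a₁′ , _) = combine a₁ a₁′
      p″ (_ , _ , _ , _ , a₁″ , _ , a₁‴ , _) = combine a₁″ a₁‴
      x x″ : Octuple A₁ A₂ → Fin (n * n)
      x  (_ , a₂ , _ , a₂′ , _) = combine a₂ a₂′
      x″ (_ , _ , _ , _ , _ , a₂″ , _ , a₂‴) = combine a₂″ a₂‴
      octuple-ext : ∀ o o′ → p o ≡ p o′ → x o ≡ x o′ → p″ o ≡ p″ o′ → x″ o ≡ x″ o′ → o ≡ o′
      octuple-ext (a₁ , a₂ , a₁′ , a₂′ , a₁″ , a₂″ , a₁‴ , a₂‴) (b₁ , b₂ , b₁′ , b₂′ , b₁″ , b₂″ , b₁‴ , b₂‴)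
        eq₁ eq₂ eq₃ eq₄
        with Fin.combine-injective a₁ a₁′ b₁ b₁′ eq₁ | Fin.combine-injective a₂ a₂′ b₂ b₂′ eq₂
           | Fin.combine-injective a₁″ a₁‴ b₁″ b₁‴ eq₃ | Fin.combine-injective a₂″ a₂‴ b₂″ b₂‴ eq₄
      ... | refl , refl | refl , refl | refl , refl | refl , refl = refl
      slope : ∀ {o} → IsSolution Z A₁ A₂ o → Fin (card Z)
      slope (_ , _ , _ , w , _) = w
      intro : ∀ w a a′ b b′ → Opposite Z A₁ A₂ w (a , a′) (b , b′) →
              Match Z A₁ A₂ w (combine a a′) (combine b b′)
      intro w a a′ b b′ = subst₂ (Opposite Z A₁ A₂ w)
        (sym (Fin.remQuot-combine a a′)) (sym (Fin.remQuot-combine b b′))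
      sum₁ : Fin m → Fin n → ℝ
      sum₁ i j = elem A₁ i ⊕ elem A₂ j
      match : ∀ o (s : IsSolution Z A₁ A₂ o) → Match Z A₁ A₂ (slope {o} s) (p o) (x o)
      match (a₁ , a₂ , a₁′ , a₂′ , _) (nz , _ , _ , w , q≃z) = intro w a₁ a₁′ a₂ a₂′
        (quotient⇒opposite (elem Z w) (elem A₁ a₁) (elem A₁ a₁′) (elem A₂ a₂) (elem A₂ a₂′) nz q≃z)
      match″ : ∀ o (s : IsSolution Z A₁ A₂ o) → Match Z A₁ A₂ (slope {o} s) (p″ o) (x″ o)
      match″ (a₁ , a₂ , a₁′ , a₂′ , a₁″ , a₂″ , a₁‴ , a₂‴) (nz , nz″ , q≃q″ , w , q≃z) = intro w a₁″ a₁‴ a₂″ a₂‴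
        (quotient⇒opposite (elem Z w) (elem A₁ a₁″) (elem A₁ a₁‴) (elem A₂ a₂″) (elem A₂ a₂‴) nz″
          (≃-trans q″ q (elem Z w) (≃-sym q q″ q≃q″) q≃z))
        where
        q  = quotient (sum₁ a₁ a₂) (sum₁ a₁′ a₂′) nz
        q″ = quotient (sum₁ a₁″ a₂″) (sum₁ a₁‴ a₂‴) nz″

  R-bound : ∀ J .{{_ : NonZero J}} → m < 2 ^ J → n < 2 ^ J → ∀ {K} → 1 ≤ K → card Z ≤ K * (m * m) → m ≤ n →
    ∀ r → R≥ Z A₁ A₂ r → r ^ 3 ≤ (2 * 2 * 2 * (J * J * (J * J)) * (162 * K)) ^ 3 * (m ^ 10 * n ^ 8)
  -- The conclusion is a decidable inequality of natural numbers, so the relations between reals may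
  -- be decided under double negation.
  R-bound J m<2^J n<2^J 1≤K q≤ m≤n r R≥r = decidable-stable (_ ≤? _) do
    dec₁   ← ¬¬-decidableRelations Z A₁
    dec₂   ← ¬¬-decidableRelations Z A₂
    match? ← ¬¬-decidable₃ (Match Z A₁ A₂)
    return (≤-trans (^-monoˡ-≤ 3 (R≤energy dec₁ dec₂ match? r R≥r))
                    (energy-bound dec₁ dec₂ match? J m<2^J n<2^J 1≤K q≤ m≤n))

-- Absorbing constants and logarithms

polylog-absorb : ∀ e f C c N → let L = ⌊log₂ (2 + N) ⌋ in
  e * e * e * (e * L * (e * L) * (e * L * (e * L))) * (f * polylog C c N) ≡
  polylog (e * e * e * (e * e * (e * e)) * f * C) (4 + c) N
polylog-absorb e f C c N = rearrange e f C ⌊log₂ (2 + N) ⌋ (⌊log₂ (2 + N) ⌋ ^ c)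
  where
  rearrange : ∀ e f C L P → e * e * e * (e * L * (e * L) * (e * L * (e * L))) * (f * (C * P)) ≡
                            e * e * e * (e * e * (e * e)) * f * C * (L * (L * (L * (L * P))))
  rearrange = solve-∀

1≤⌊log₂[2+n]⌋ : ∀ n → 1 ≤ ⌊log₂ (2 + n) ⌋
1≤⌊log₂[2+n]⌋ n = ⌊log₂⌋-mono-≤ {2} (m≤m+n 2 n)

-- The number of dyadic classes is taken to be twice the logarithm, not one more than it, so that
-- its fourth power is a constant times a power of the logarithm. This suffices since the logarithm
-- is at least 1.
n<2^2⌊log₂[2+N]⌋ : ∀ {n N} → n ≤ N → n < 2 ^ (2 * ⌊log₂ (2 + N) ⌋)
n<2^2⌊log₂[2+N]⌋ {n} {N} n≤N = begin-strict
  n                           ≤⟨ ≤-trans n≤N (m≤n+m N 2) ⟩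
  2 + N                       <⟨ n<2^⌊log₂n⌋+1 (2 + N) ⟩
  2 ^ (1 + ⌊log₂ (2 + N) ⌋)   ≤⟨ ^-monoʳ-≤ 2 (+-mono-≤ (1≤⌊log₂[2+n]⌋ N) (m≤m+n _ 0)) ⟩
  2 ^ (2 * ⌊log₂ (2 + N) ⌋)   ∎
  where open ≤-Reasoning

-- Cubing clears the denominators of the exponents 10/3 and 8/3, so the bound is stated in natural
-- numbers.
mainTheorem2 : ∀ (C₀ c₀ : ℕ) → 0 < C₀ → 0 < c₀ →
    ∃ λ (C : ℕ) → ∃ λ (c : ℕ) → 0 < C × 0 < c ×
    (∀ (A₁ A₂ Z : FiniteSubset) →
    let N = card A₁ ⊔ card A₂ ⊔ card Z in
    card A₁ ≤ card A₂ →
    card Z ≤ polylog C₀ c₀ N * card A₁ ^ 2 →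
    ∀ (r : ℕ) → R≥ Z A₁ A₂ r →
    r ^ 3 ≤ polylog C c N ^ 3 * (card A₁ ^ 10 * card A₂ ^ 8))
mainTheorem2 C₀ c₀ 0<C₀ _ =
  -- The first 2³ comes from dyadic rounding, 2⁴ and the exponent 4 from the fourth power of the
  -- number `2 * L` of classes, 162 from the count of rich lines, and `C₀` and `c₀` from the bound
  -- on `card Z`.
  2 * 2 * 2 * (2 * 2 * (2 * 2)) * 162 * C₀ , 4 + c₀ , ≤-trans 0<C₀ (m≤n*m C₀ (2 * 2 * 2 * (2 * 2 * (2 * 2)) * 162)) , s≤s z≤n , bound
  where
  bound : ∀ (A₁ A₂ Z : FiniteSubset) →
    let N = card A₁ ⊔ card A₂ ⊔ card Z in
    card A₁ ≤ card A₂ →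
    card Z ≤ polylog C₀ c₀ N * card A₁ ^ 2 →
    ∀ (r : ℕ) → R≥ Z A₁ A₂ r →
    r ^ 3 ≤ polylog (2 * 2 * 2 * (2 * 2 * (2 * 2)) * 162 * C₀) (4 + c₀) N ^ 3 * (card A₁ ^ 10 * card A₂ ^ 8)
  bound A₁ A₂ Z m≤n q≤ r R≥r =
    subst (λ B → r ^ 3 ≤ B ^ 3 * (card A₁ ^ 10 * card A₂ ^ 8)) (polylog-absorb 2 162 C₀ c₀ N)
      (R-bound Z A₁ A₂ (2 * L) {{m*n≢0 2 L {{_}} {{L≢0}}}} (n<2^2⌊log₂[2+N]⌋ m≤N) (n<2^2⌊log₂[2+N]⌋ n≤N)
        (*-mono-≤ 0<C₀ (m^n>0 L {{L≢0}} c₀))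
        (subst (λ s → card Z ≤ polylog C₀ c₀ N * (card A₁ * s)) (*-identityʳ (card A₁)) q≤)
        m≤n r R≥r)
    where
    N = card A₁ ⊔ card A₂ ⊔ card Z
    L = ⌊log₂ (2 + N) ⌋
    L≢0 : NonZero L
    L≢0 = >-nonZero (1≤⌊log₂[2+n]⌋ N)
    m≤N : card A₁ ≤ N
    m≤N = ≤-trans (m≤m⊔n (card A₁) (card A₂)) (m≤m⊔n (card A₁ ⊔ card A₂) (card Z))
    n≤N : card A₂ ≤ N
    n≤N = ≤-trans (m≤n⊔m (card A₁) (card A₂)) (m≤m⊔n (card A₁ ⊔ card A₂) (card Z))
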